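{- Let $k\in\mathbb{N}$ and let $f:\mathbb{N}^k\to\mathbb{C}$ be an arithmetic function of $k$ variables. Assume that $$\sum_{n_1,\ldots,n_k=1}^{\infty} 2^{\omega(n_1)+\cdots+\omega(n_k)}\,\frac{|(\mu^*_k\times f)(n_1,\ldots,n_k)|}{n_1\cdots n_k}<\infty .$$ Then for every $n_1,\ldots,n_k\in\mathbb{N}$, $$f(n_1,\ldots,n_k)=\sum_{q_1,\ldots,q_k=1}^{\infty}\widetilde{a}_{q_1,\ldots,q_k}\,\widetilde{c}_{q_1}(n_1)\cdots\widetilde{c}_{q_k}(n_k),$$ where $$\widetilde{a}_{q_1,\ldots,q_k}=\sum_{\substack{m_1,\ldots,m_k=1\\(m_1,q_1)=1,\ldots,(m_k,q_k)=1}}^{\infty}\frac{(\mu^*_k\times f)(m_1q_1,\ldots,m_kq_k)}{m_1q_1\cdots m_kq_k},$$ and the series over $q_1,\ldots,q_k$ is absolutely convergent.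
   Context: $\mathbb{N}=\{1,2,\ldots\}$; $(a,b)$ denotes the greatest common divisor; $\omega(n)$ is the number of distinct prime divisors of $n$. A positive integer $d$ is a unitary divisor of $n$, written $d\parallel n$, if $d\mid n$ and $(d,n/d)=1$. Put $\mu^*(n)=(-1)^{\omega(n)}$ and $\mu^*_k(n_1,\ldots,n_k)=\mu^*(n_1)\cdots\mu^*(n_k)$. The unitary convolution of $f,g:\mathbb{N}^k\to\mathbb{C}$ is $$(f\times g)(n_1,\ldots,n_k)=\sum_{d_1\parallel n_1,\ldots,d_k\parallel n_k} f(d_1,\ldots,d_k)\,g(n_1/d_1,\ldots,n_k/d_k).$$ The modified unitary Ramanujan sums $\widetilde{c}_q(n)$ ($q,n\in\mathbb{N}$) are the functions determined by $$\sum_{d\parallel q}\widetilde{c}_d(n)=\begin{cases} q,&\text{if } q\parallel n,\\ 0,&\text{otherwise;}\end{cases}$$ equivalently, $\widetilde{c}_q(n)=\sum_{d\parallel n,\ d\parallel q} d\,\mu^*(q/d)$. -}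

module Defs where

open import Data.Bool.Base using (if_then_else_)
open import Data.Integer.Base as ℤ using (ℤ; +_)
import Data.Integer.Properties as ℤ
open import Data.List.Base using (List; []; _∷_; map; filter; foldr; length; upTo; cartesianProductWith)
open import Data.Nat.Base as ℕ using (ℕ; zero; suc)
open import Data.Nat.Divisibility using (_∣_; _∣?_)
open import Data.Nat.DivMod using (m/n*n≤m; m≡m%n+[m/n]*n; m%n<n)
open import Data.Nat.GCD using (gcd)
open import Data.Nat.Primality using (prime?)
import Data.Nat.Properties as ℕ
open import Data.Product.Base using (_×_; _,_; ∃)
open import Data.Rational.Base as ℚ using (ℚ; 0ℚ; 1ℚ; ½)
import Data.Rational.Properties as ℚ
open import Data.Rational.Solver using (module +-*-Solver)
import Data.Rational.Unnormalised.Base as ℚᵘ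
import Data.Rational.Unnormalised.Properties as ℚᵘ
open import Data.Sum.Base using (inj₁; inj₂)
open import Data.Vec.Base as Vec using (Vec; []; _∷_; zipWith)
open import Data.Vec.Relation.Unary.All using (All)
import Data.Vec.Relation.Binary.Pointwise.Inductive as Pointwise
open import Relation.Binary.PropositionalEquality using (_≡_; refl; sym; trans; cong; cong₂; subst; subst₂)
open import Relation.Nullary.Decidable using (Dec; yes; no; does; _×-dec_)
open import Relation.Nullary.Negation using (contradiction)

module _ where
  open import Data.Rational.Base
  open +-*-Solver

  p-p≡0 : ∀ p → p - p ≡ 0ℚ
  p-p≡0 = ℚ.+-inverseʳ

  half+half : ∀ p → p * ½ + p * ½ ≡ p
  half+half = solve 1 (λ p → p :* con ½ :+ p :* con ½ := p) refl

  *-pos : ∀ {p q} → 0ℚ < p → 0ℚ < q → 0ℚ < p * q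
  *-pos {p} {q} 0<p 0<q = ℚ.positive⁻¹ (p * q) {{ℚ.pos*pos⇒pos p {{positive 0<p}} q {{positive 0<q}}}}

  0<½ : 0ℚ < ½
  0<½ = ℚ.positive⁻¹ ½

  0<1 : 0ℚ < 1ℚ
  0<1 = ℚ.positive⁻¹ 1ℚ

  *-mono-≤ : ∀ {p q r s} → 0ℚ ≤ p → 0ℚ ≤ s → p ≤ q → r ≤ s → p * r ≤ q * s
  *-mono-≤ {p} {q} {r} {s} 0≤p 0≤s p≤q r≤s = ℚ.≤-trans
    (ℚ.*-monoˡ-≤-nonNeg p {{nonNegative 0≤p}} r≤s)
    (ℚ.*-monoʳ-≤-nonNeg s {{nonNegative 0≤s}} p≤q)

  p≤∣p∣ : ∀ p → p ≤ ∣ p ∣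
  p≤∣p∣ p with ℚ.≤-total 0ℚ p
  ... | inj₁ 0≤p = ℚ.≤-reflexive (sym (ℚ.0≤p⇒∣p∣≡p 0≤p))
  ... | inj₂ p≤0 = ℚ.≤-trans p≤0 (ℚ.0≤∣p∣ p)

  ∣p-q∣≡∣q-p∣ : ∀ p q → ∣ p - q ∣ ≡ ∣ q - p ∣
  ∣p-q∣≡∣q-p∣ p q = trans
    (cong ∣_∣ (solve 2 (λ p q → p :- q := :- (q :- p)) refl p q))
    (ℚ.∣-p∣≡∣p∣ (q - p))

  p≤q+r⇒p-q≤r : ∀ {p q r} → p ≤ q + r → p - q ≤ r
  p≤q+r⇒p-q≤r {p} {q} {r} p≤q+r = subst (p - q ≤_)
    (solve 2 (λ q r → q :+ r :- q := r) refl q r)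
    (ℚ.+-monoˡ-≤ (- q) p≤q+r)

  p-q≤r⇒p≤q+r : ∀ {p q r} → p - q ≤ r → p ≤ q + r
  p-q≤r⇒p≤q+r {p} {q} {r} p-q≤r = subst (_≤ q + r)
    (solve 2 (λ p q → q :+ (p :- q) := p) refl p q)
    (ℚ.+-monoʳ-≤ q p-q≤r)

  ∣p∣≤r : ∀ {p r} → p ≤ r → - p ≤ r → ∣ p ∣ ≤ r
  ∣p∣≤r {p} {r} p≤r -p≤r with ℚ.∣p∣≡p∨∣p∣≡-p p
  ... | inj₁ e = subst (_≤ r) (sym e) p≤r
  ... | inj₂ e = subst (_≤ r) (sym e) -p≤r

  ∣p-q∣≤r : ∀ {p q r} → p ≤ q + r → q ≤ p + r → ∣ p - q ∣ ≤ r
  ∣p-q∣≤r {p} {q} {r} p≤q+r q≤p+r = ∣p∣≤r (p≤q+r⇒p-q≤r p≤q+r)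
    (subst (_≤ r) (solve 2 (λ p q → q :- p := :- (p :- q)) refl p q) (p≤q+r⇒p-q≤r q≤p+r))

  ∣p∣≤∣q∣+∣p-q∣ : ∀ p q → ∣ p ∣ ≤ ∣ q ∣ + ∣ p - q ∣
  ∣p∣≤∣q∣+∣p-q∣ p q = subst (λ t → ∣ t ∣ ≤ ∣ q ∣ + ∣ p - q ∣)
    (solve 2 (λ p q → q :+ (p :- q) := p) refl p q)
    (ℚ.∣p+q∣≤∣p∣+∣q∣ q (p - q))

  ∣∣p∣-∣q∣∣≤∣p-q∣ : ∀ p q → ∣ ∣ p ∣ - ∣ q ∣ ∣ ≤ ∣ p - q ∣
  ∣∣p∣-∣q∣∣≤∣p-q∣ p q = ∣p-q∣≤r (∣p∣≤∣q∣+∣p-q∣ p q)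
    (subst (λ t → ∣ q ∣ ≤ ∣ p ∣ + t) (∣p-q∣≡∣q-p∣ q p) (∣p∣≤∣q∣+∣p-q∣ q p))

-- Stated with Σ-types, so a real number carries a modulus of convergence.

Cauchy : (ℕ → ℚ) → Set
Cauchy x = ∀ ε → 0ℚ ℚ.< ε →
  ∃ λ N → ∀ m n → N ℕ.≤ m → N ℕ.≤ n → ℚ.∣ x m ℚ.- x n ∣ ℚ.≤ ε

module _ where
  open import Data.Rational.Base
  open +-*-Solver

  const-cauchy : ∀ p → Cauchy (λ _ → p)
  const-cauchy p ε 0<ε = 0 , λ _ _ _ _ →
    subst (λ t → ∣ t ∣ ≤ ε) (sym (p-p≡0 p)) (ℚ.<⇒≤ 0<ε)

  +-cauchy : ∀ {x y} → Cauchy x → Cauchy y → Cauchy (λ n → x n + y n)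
  +-cauchy {x} {y} cx cy ε 0<ε =
    let ε/2 = ε * ½
        M , hx = cx ε/2 (*-pos 0<ε 0<½)
        N , hy = cy ε/2 (*-pos 0<ε 0<½)
    in M ℕ.⊔ N , λ m n hm hn → begin
      ∣ (x m + y m) - (x n + y n) ∣
        ≡⟨ cong ∣_∣ (solve 4 (λ a b c d → (a :+ b) :- (c :+ d) := (a :- c) :+ (b :- d)) refl (x m) (y m) (x n) (y n)) ⟩
      ∣ (x m - x n) + (y m - y n) ∣
        ≤⟨ ℚ.∣p+q∣≤∣p∣+∣q∣ (x m - x n) (y m - y n) ⟩
      ∣ x m - x n ∣ + ∣ y m - y n ∣
        ≤⟨ ℚ.+-mono-≤ (hx m n (ℕ.m⊔n≤o⇒m≤o M N hm) (ℕ.m⊔n≤o⇒m≤o M N hn))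
                      (hy m n (ℕ.m⊔n≤o⇒n≤o M N hm) (ℕ.m⊔n≤o⇒n≤o M N hn)) ⟩
      ε/2 + ε/2
        ≡⟨ half+half ε ⟩
      ε ∎
    where open ℚ.≤-Reasoning

  neg-cauchy : ∀ {x} → Cauchy x → Cauchy (λ n → - x n)
  neg-cauchy {x} cx ε 0<ε =
    let N , h = cx ε 0<ε
    in N , λ m n hm hn → subst (_≤ ε)
      (trans (∣p-q∣≡∣q-p∣ (x m) (x n))
        (cong ∣_∣ (solve 2 (λ a b → b :- a := (:- a) :- (:- b)) refl (x m) (x n))))
      (h m n hm hn)

  abs-cauchy : ∀ {x} → Cauchy x → Cauchy (λ n → ∣ x n ∣)
  abs-cauchy {x} cx ε 0<ε =
    let N , h = cx ε 0<ε
    in N , λ m n hm hn → ℚ.≤-trans (∣∣p∣-∣q∣∣≤∣p-q∣ (x m) (x n)) (h m n hm hn)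

  eventually-bounded : ∀ {x} → Cauchy x →
    ∃ λ B → 0ℚ < B × ∃ λ N → ∀ n → N ℕ.≤ n → ∣ x n ∣ ≤ B
  eventually-bounded {x} cx =
    let N , h = cx 1ℚ 0<1
    in ∣ x N ∣ + 1ℚ , ℚ.+-mono-≤-< (ℚ.0≤∣p∣ (x N)) 0<1 , N , λ n hn →
       ℚ.≤-trans (∣p∣≤∣q∣+∣p-q∣ (x n) (x N)) (ℚ.+-monoʳ-≤ ∣ x N ∣ (h n N hn ℕ.≤-refl))

  scale : ∀ {ε B} → 0ℚ < ε → 0ℚ < B → ∃ λ δ → 0ℚ < δ × B * δ ≡ ε
  scale {ε} {B} 0<ε 0<B =
    ε * 1/B , *-pos 0<ε (ℚ.positive⁻¹ 1/B {{ℚ.1/pos⇒pos B {{B⁺}}}}) , (begin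
      B * (ε * 1/B)   ≡⟨ solve 3 (λ b e i → b :* (e :* i) := e :* (b :* i)) refl B ε 1/B ⟩
      ε * (B * 1/B)   ≡⟨ cong (ε *_) (ℚ.*-inverseʳ B {{B≢0}}) ⟩
      ε * 1ℚ          ≡⟨ ℚ.*-identityʳ ε ⟩
      ε               ∎)
    where
    open Relation.Binary.PropositionalEquality.≡-Reasoning
    B⁺ = positive 0<B
    B≢0 = ℚ.pos⇒nonZero B {{B⁺}}
    1/B = (1/ B) {{B≢0}}

  *-cauchy : ∀ {x y} → Cauchy x → Cauchy y → Cauchy (λ n → x n * y n)
  *-cauchy {x} {y} cx cy ε 0<ε =
    let ε/2 = ε * ½
        0<ε/2 = *-pos 0<ε 0<½
        A , 0<A , K , hA = eventually-bounded cx
        B , 0<B , L , hB = eventually-bounded cy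
        δ , 0<δ , Bδ≡ε/2 = scale 0<ε/2 0<B
        η , 0<η , Aη≡ε/2 = scale 0<ε/2 0<A
        M , hx = cx δ 0<δ
        N , hy = cy η 0<η
        h₁ = λ m → ℕ.m⊔n≤o⇒m≤o {m} (K ℕ.⊔ L) (M ℕ.⊔ N)
        h₂ = λ m → ℕ.m⊔n≤o⇒n≤o {m} (K ℕ.⊔ L) (M ℕ.⊔ N)
    in (K ℕ.⊔ L) ℕ.⊔ (M ℕ.⊔ N) , λ m n hm hn → begin
      ∣ x m * y m - x n * y n ∣
        ≡⟨ cong ∣_∣ (solve 4 (λ a b c d → a :* b :- c :* d := a :* (b :- d) :+ d :* (a :- c)) refl (x m) (y m) (x n) (y n)) ⟩
      ∣ x m * (y m - y n) + y n * (x m - x n) ∣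
        ≤⟨ ℚ.∣p+q∣≤∣p∣+∣q∣ (x m * (y m - y n)) (y n * (x m - x n)) ⟩
      ∣ x m * (y m - y n) ∣ + ∣ y n * (x m - x n) ∣
        ≡⟨ cong₂ _+_ (ℚ.∣p*q∣≡∣p∣*∣q∣ (x m) (y m - y n)) (ℚ.∣p*q∣≡∣p∣*∣q∣ (y n) (x m - x n)) ⟩
      ∣ x m ∣ * ∣ y m - y n ∣ + ∣ y n ∣ * ∣ x m - x n ∣
        ≤⟨ ℚ.+-mono-≤
             (*-mono-≤ (ℚ.0≤∣p∣ (x m)) (ℚ.<⇒≤ 0<η) (hA m (ℕ.m⊔n≤o⇒m≤o K L (h₁ m hm)))
               (hy m n (ℕ.m⊔n≤o⇒n≤o M N (h₂ m hm)) (ℕ.m⊔n≤o⇒n≤o M N (h₂ n hn))))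
             (*-mono-≤ (ℚ.0≤∣p∣ (y n)) (ℚ.<⇒≤ 0<δ) (hB n (ℕ.m⊔n≤o⇒n≤o K L (h₁ n hn)))
               (hx m n (ℕ.m⊔n≤o⇒m≤o M N (h₂ m hm)) (ℕ.m⊔n≤o⇒m≤o M N (h₂ n hn)))) ⟩
      A * η + B * δ
        ≡⟨ cong₂ _+_ Aη≡ε/2 Bδ≡ε/2 ⟩
      ε/2 + ε/2
        ≡⟨ half+half ε ⟩
      ε ∎
    where open ℚ.≤-Reasoning

isqrt : ℕ → ℕ
isqrt zero    = zero
isqrt (suc n) with suc (isqrt n) ℕ.* suc (isqrt n) ℕ.≤? suc n
... | yes _ = suc (isqrt n)
... | no  _ = isqrt n

isqrt-lower : ∀ n → isqrt n ℕ.* isqrt n ℕ.≤ n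
isqrt-lower zero    = ℕ.z≤n
isqrt-lower (suc n) with suc (isqrt n) ℕ.* suc (isqrt n) ℕ.≤? suc n
... | yes h = h
... | no  _ = ℕ.m≤n⇒m≤1+n (isqrt-lower n)

isqrt-upper : ∀ n → n ℕ.< suc (isqrt n) ℕ.* suc (isqrt n)
isqrt-upper zero    = ℕ.s≤s ℕ.z≤n
isqrt-upper (suc n) with suc (isqrt n) ℕ.* suc (isqrt n) ℕ.≤? suc n
... | no  h = ℕ.≰⇒> h
... | yes _ = ℕ.s≤s (ℕ.≤-trans (isqrt-upper n) (ℕ.≤-trans (ℕ.*-monoʳ-≤ s (ℕ.n≤1+n s)) (ℕ.m≤n+m (s ℕ.* suc s) s)))
  where s = suc (isqrt n)

module _ where
  open import Data.Rational.Base hiding (NonZero)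
  open +-*-Solver

  ι : ℕ → ℕ → ℚ
  ι s n = + s / suc n

  -- √∣ p ∣ rounded down to a multiple of 1/(n+1)
  √ℚ-num : ℕ → ℚ → ℕ
  √ℚ-num n p = isqrt (ℤ.∣ ↥ p ∣ ℕ.* (suc n ℕ.* suc n) ℕ./ ↧ₙ p)

  √ℚ : ℕ → ℚ → ℚ
  √ℚ n p = ι (√ℚ-num n p) n

  toℚᵘ-ι² : ∀ s n → toℚᵘ (ι s n * ι s n) ℚᵘ.≃ (ℚᵘ.mkℚᵘ (+ s) n ℚᵘ.* ℚᵘ.mkℚᵘ (+ s) n)
  toℚᵘ-ι² s n = ℚᵘ.≃-trans (ℚ.toℚᵘ-homo-* (ι s n) (ι s n))
    (ℚᵘ.*-cong (ℚ.toℚᵘ-fromℚᵘ (ℚᵘ.mkℚᵘ (+ s) n)) (ℚ.toℚᵘ-fromℚᵘ (ℚᵘ.mkℚᵘ (+ s) n)))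

  √ℚ-lower : ∀ n p → √ℚ n p * √ℚ n p ≤ ∣ p ∣
  √ℚ-lower n p@(mkℚ u d _) = ℚ.toℚᵘ-cancel-≤ (ℚᵘ.≤-respˡ-≃ (ℚᵘ.≃-sym (toℚᵘ-ι² s n)) (ℚᵘ.*≤* le))
    where
    s = √ℚ-num n p
    a = ℤ.∣ u ∣
    M² = suc n ℕ.* suc n
    leℕ : (s ℕ.* s) ℕ.* suc d ℕ.≤ a ℕ.* M²
    leℕ = ℕ.≤-trans (ℕ.*-monoˡ-≤ (suc d) (isqrt-lower (a ℕ.* M² ℕ./ suc d))) (m/n*n≤m (a ℕ.* M²) (suc d))
    le : (+ s ℤ.* + s) ℤ.* + suc d ℤ.≤ + a ℤ.* + M²
    le = subst₂ ℤ._≤_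
      (trans (ℤ.pos-* (s ℕ.* s) (suc d)) (cong (ℤ._* + suc d) (ℤ.pos-* s s)))
      (ℤ.pos-* a M²)
      (ℤ.+≤+ leℕ)

  √ℚ-upper : ∀ n p → ∣ p ∣ < ι (suc (√ℚ-num n p)) n * ι (suc (√ℚ-num n p)) n
  √ℚ-upper n p@(mkℚ u d _) = ℚ.toℚᵘ-cancel-< (ℚᵘ.<-respʳ-≃ (ℚᵘ.≃-sym (toℚᵘ-ι² t n)) (ℚᵘ.*<* lt))
    where
    t = suc (√ℚ-num n p)
    a = ℤ.∣ u ∣
    M² = suc n ℕ.* suc n
    x = a ℕ.* M²
    open ℕ.≤-Reasoning
    ltℕ : x ℕ.< (t ℕ.* t) ℕ.* suc d
    ltℕ = begin-strict
      x                                          ≡⟨ m≡m%n+[m/n]*n x (suc d) ⟩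
      x ℕ.% suc d ℕ.+ (x ℕ./ suc d) ℕ.* suc d    <⟨ ℕ.+-monoˡ-< _ (m%n<n x (suc d)) ⟩
      suc (x ℕ./ suc d) ℕ.* suc d                ≤⟨ ℕ.*-monoˡ-≤ (suc d) (isqrt-upper (x ℕ./ suc d)) ⟩
      (t ℕ.* t) ℕ.* suc d                        ∎
    lt : + a ℤ.* + M² ℤ.< (+ t ℤ.* + t) ℤ.* + suc d
    lt = subst₂ ℤ._<_
      (ℤ.pos-* a M²)
      (trans (ℤ.pos-* (t ℕ.* t) (suc d)) (cong (ℤ._* + suc d) (ℤ.pos-* t t)))
      (ℤ.+<+ ltℕ)

  0≤ι : ∀ s n → 0ℚ ≤ ι s n
  0≤ι s n = ℚ.nonNegative⁻¹ (ι s n) {{ℚ.normalize-nonNeg s (suc n)}}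

  ι-suc : ∀ s n → ι (suc s) n ≡ ι s n + ι 1 n
  ι-suc s n = ℚ.toℚᵘ-injective (begin
    toℚᵘ (ι (suc s) n)                       ≈⟨ ℚ.toℚᵘ-fromℚᵘ (ℚᵘ.mkℚᵘ (+ suc s) n) ⟩
    ℚᵘ.mkℚᵘ (+ suc s) n                      ≈⟨ ℚᵘ.*≡* eq ⟩
    ℚᵘ.mkℚᵘ (+ s) n ℚᵘ.+ ℚᵘ.mkℚᵘ (+ 1) n     ≈⟨ ℚᵘ.≃-sym (ℚᵘ.+-cong (ℚ.toℚᵘ-fromℚᵘ (ℚᵘ.mkℚᵘ (+ s) n)) (ℚ.toℚᵘ-fromℚᵘ (ℚᵘ.mkℚᵘ (+ 1) n))) ⟩
    toℚᵘ (ι s n) ℚᵘ.+ toℚᵘ (ι 1 n)           ≈⟨ ℚᵘ.≃-sym (ℚ.toℚᵘ-homo-+ (ι s n) (ι 1 n)) ⟩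
    toℚᵘ (ι s n + ι 1 n)                     ∎)
    where
    open import Relation.Binary.Reasoning.Setoid ℚᵘ.≃-setoid
    open import Data.Integer.Solver using () renaming (module +-*-Solver to ℤ-Solver)
    M = + suc n
    eq : + suc s ℤ.* (M ℤ.* M) ≡ (+ s ℤ.* M ℤ.+ + 1 ℤ.* M) ℤ.* M
    eq = ℤ-Solver.solve 2 (λ s M → (ℤ-Solver.con (+ 1) ℤ-Solver.:+ s) ℤ-Solver.:* (M ℤ-Solver.:* M)
           ℤ-Solver.:= (s ℤ-Solver.:* M ℤ-Solver.:+ ℤ-Solver.con (+ 1) ℤ-Solver.:* M) ℤ-Solver.:* M) refl (+ s) M

  ι-archimedean : ∀ ε → 0ℚ < ε → ∃ λ N → ∀ n → N ℕ.≤ n → ι 1 n ≤ ε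
  ι-archimedean ε@(mkℚ u d _) 0<ε = d , λ n d≤n → ℚ.toℚᵘ-cancel-≤
    (ℚᵘ.≤-respˡ-≃ (ℚᵘ.≃-sym (ℚ.toℚᵘ-fromℚᵘ (ℚᵘ.mkℚᵘ (+ 1) n)))
      (ℚᵘ.*≤* (le u (positive 0<ε) n d≤n)))
    where
    le : ∀ u → ℤ.Positive u → ∀ n → d ℕ.≤ n → + 1 ℤ.* + suc d ℤ.≤ u ℤ.* + suc n
    le (+ suc a) _ n d≤n = ℤ.+≤+ (ℕ.*-mono-≤ (ℕ.s≤s (ℕ.z≤n {a})) (ℕ.s≤s d≤n))

  square-cancel : ∀ {a c h e p q} → 0ℚ ≤ c → 0ℚ ≤ h → 0ℚ < e →
    a * a ≤ p → q < (c + h) * (c + h) → p ≤ q + e * e → a ≤ c + (h + e)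
  square-cancel {a} {c} {h} {e} {p} {q} 0≤c 0≤h 0<e a²≤p q<[c+h]² p≤q+e² =
    ℚ.≮⇒≥ λ c+h+e<a → ℚ.<-irrefl refl (begin-strict
      p                                            ≤⟨ p≤q+e² ⟩
      q + e * e                                    <⟨ ℚ.+-monoˡ-< (e * e) q<[c+h]² ⟩
      (c + h) * (c + h) + e * e                    ≡⟨ sym (ℚ.+-identityʳ _) ⟩
      (c + h) * (c + h) + e * e + 0ℚ               ≤⟨ ℚ.+-monoʳ-≤ ((c + h) * (c + h) + e * e) 0≤2[c+h]e ⟩
      (c + h) * (c + h) + e * e + ((c + h) * e + (c + h) * e)
        ≡⟨ solve 3 (λ c h e → (c :+ h) :* (c :+ h) :+ e :* e :+ ((c :+ h) :* e :+ (c :+ h) :* e)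
                              := (c :+ (h :+ e)) :* (c :+ (h :+ e))) refl c h e ⟩
      (c + (h + e)) * (c + (h + e))
        ≤⟨ *-mono-≤ 0≤c+h+e (ℚ.≤-trans 0≤c+h+e (ℚ.<⇒≤ c+h+e<a)) (ℚ.<⇒≤ c+h+e<a) (ℚ.<⇒≤ c+h+e<a) ⟩
      a * a                                        ≤⟨ a²≤p ⟩
      p                                            ∎)
    where
    open ℚ.≤-Reasoning
    0≤c+h : 0ℚ ≤ c + h
    0≤c+h = ℚ.+-mono-≤ 0≤c 0≤h
    0≤c+h+e : 0ℚ ≤ c + (h + e)
    0≤c+h+e = ℚ.+-mono-≤ 0≤c (ℚ.+-mono-≤ 0≤h (ℚ.<⇒≤ 0<e))
    0≤[c+h]e : 0ℚ ≤ (c + h) * e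
    0≤[c+h]e = subst (_≤ (c + h) * e) (ℚ.*-zeroʳ (c + h)) (ℚ.*-monoˡ-≤-nonNeg (c + h) {{nonNegative 0≤c+h}} (ℚ.<⇒≤ 0<e))
    0≤2[c+h]e : 0ℚ ≤ (c + h) * e + (c + h) * e
    0≤2[c+h]e = ℚ.+-mono-≤ 0≤[c+h]e 0≤[c+h]e

  √-cauchy : ∀ {x} → Cauchy x → Cauchy (λ n → √ℚ n (x n))
  √-cauchy {x} cx ε 0<ε =
    let M , hM = ι-archimedean e 0<e
        N , hN = cx (e * e) (*-pos 0<e 0<e)
        close : ∀ m n → M ℕ.⊔ N ℕ.≤ m → M ℕ.⊔ N ℕ.≤ n → √ℚ m (x m) ≤ √ℚ n (x n) + ε
        close m n hm hn = ℚ.≤-trans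
          (square-cancel {q = ∣ x n ∣} (0≤ι (√ℚ-num n (x n)) n) (0≤ι 1 n) 0<e
            (√ℚ-lower m (x m))
            (subst (λ t → ∣ x n ∣ < t * t) (ι-suc (√ℚ-num n (x n)) n) (√ℚ-upper n (x n)))
            (ℚ.≤-trans (∣p∣≤∣q∣+∣p-q∣ (x m) (x n))
              (ℚ.+-monoʳ-≤ ∣ x n ∣ (hN m n (ℕ.m⊔n≤o⇒n≤o M N hm) (ℕ.m⊔n≤o⇒n≤o M N hn)))))
          (ℚ.+-monoʳ-≤ (√ℚ n (x n))
            (ℚ.≤-trans (ℚ.+-monoˡ-≤ e (hM n (ℕ.m⊔n≤o⇒m≤o M N hn))) (ℚ.≤-reflexive (half+half ε))))
    in M ℕ.⊔ N , λ m n hm hn → ∣p-q∣≤r (close m n hm hn) (close n m hn hm)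
    where
    e = ε * ½
    0<e = *-pos 0<ε 0<½

record ℝ : Set where
  constructor mkℝ
  field
    seq    : ℕ → ℚ
    cauchy : Cauchy seq

open ℝ public

infix  8 -ℝ_
infixl 7 _*ℝ_
infixl 6 _+ℝ_ _-ℝ_
infix  4 _≤ℝ_

fromℚ : ℚ → ℝ
fromℚ p = mkℝ (λ _ → p) (const-cauchy p)

0ℝ : ℝ
0ℝ = fromℚ 0ℚ

_+ℝ_ _*ℝ_ : ℝ → ℝ → ℝ
x +ℝ y = mkℝ (λ n → seq x n ℚ.+ seq y n) (+-cauchy {seq x} {seq y} (cauchy x) (cauchy y))
x *ℝ y = mkℝ (λ n → seq x n ℚ.* seq y n) (*-cauchy {seq x} {seq y} (cauchy x) (cauchy y))

-ℝ_ : ℝ → ℝ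
-ℝ x = mkℝ (λ n → ℚ.- seq x n) (neg-cauchy {seq x} (cauchy x))

_-ℝ_ : ℝ → ℝ → ℝ
x -ℝ y = x +ℝ (-ℝ y)

∣_∣ℝ : ℝ → ℝ
∣ x ∣ℝ = mkℝ (λ n → ℚ.∣ seq x n ∣) (abs-cauchy {seq x} (cauchy x))

-- The square root of the absolute value of x, so that it is total.
√∣_∣ : ℝ → ℝ
√∣ x ∣ = mkℝ (λ n → √ℚ n (seq x n)) (√-cauchy {seq x} (cauchy x))

_≤ℝ_ : ℝ → ℝ → Set
x ≤ℝ y = ∀ ε → 0ℚ ℚ.< ε → ∃ λ N → ∀ n → N ℕ.≤ n → seq x n ℚ.≤ seq y n ℚ.+ ε

record ℂ : Set where
  constructor _+i_
  field
    re im : ℝ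

open ℂ public

infixl 7 _*ℂ_
infixl 6 _+ℂ_ _-ℂ_

0ℂ : ℂ
0ℂ = 0ℝ +i 0ℝ

_+ℂ_ _-ℂ_ _*ℂ_ : ℂ → ℂ → ℂ
z +ℂ w = (re z +ℝ re w) +i (im z +ℝ im w)
z -ℂ w = (re z -ℝ re w) +i (im z -ℝ im w)
z *ℂ w = (re z *ℝ re w -ℝ im z *ℝ im w) +i (re z *ℝ im w +ℝ im z *ℝ re w)

∣_∣ℂ : ℂ → ℝ
∣ z ∣ℂ = √∣ re z *ℝ re z +ℝ im z *ℝ im z ∣

fromℤ : ℤ → ℂ
fromℤ z = fromℚ (z ℚ./ 1) +i 0ℝ

-- {1, 2, …}, represented by the predecessor so that every value is
-- definitionally a suc and hence a NonZero divisor.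
record ℕ⁺ : Set where
  constructor 1+_
  field
    pred : ℕ

  val : ℕ
  val = suc pred

open ℕ⁺ public using (val)

infixl 7 _*⁺_ _÷_

1⁺ : ℕ⁺
1⁺ = 1+ 0

_*⁺_ : ℕ⁺ → ℕ⁺ → ℕ⁺
m *⁺ n = 1+ ℕ.pred (val m ℕ.* val n)

-- n ÷ d is n / d whenever d divides n; it takes the junk value 1 when n < d.
_÷_ : ℕ⁺ → ℕ⁺ → ℕ⁺
n ÷ d = 1+ ℕ.pred (val n ℕ./ val d)

∏⁺ : ∀ {k} → Vec ℕ⁺ k → ℕ⁺
∏⁺ = Vec.foldr′ _*⁺_ 1⁺

∏ℤ : ∀ {k} → Vec ℤ k → ℤ
∏ℤ = Vec.foldr′ ℤ._*_ (+ 1)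

_/ℝ_ : ℝ → ℕ⁺ → ℝ
x /ℝ n = x *ℝ fromℚ (+ 1 ℚ./ val n)

_/ℂ_ : ℂ → ℕ⁺ → ℂ
z /ℂ n = (re z /ℝ n) +i (im z /ℝ n)

infixl 7 _/ℝ_ _/ℂ_

[1⋯_] : ℕ → List ℕ⁺
[1⋯ n ] = map 1+_ (upTo n)

choices : ∀ {A : Set} {k} → Vec (List A) k → List (Vec A k)
choices []         = [] ∷ []
choices (xs ∷ xss) = cartesianProductWith _∷_ xs (choices xss)

∑ℤ : ∀ {A : Set} → List A → (A → ℤ) → ℤ
∑ℤ xs f = foldr (λ x s → f x ℤ.+ s) (+ 0) xs

∑ℝ : ∀ {A : Set} → List A → (A → ℝ) → ℝ
∑ℝ xs f = foldr (λ x s → f x +ℝ s) 0ℝ xs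

∑ℂ : ∀ {A : Set} → List A → (A → ℂ) → ℂ
∑ℂ xs f = foldr (λ x s → f x +ℂ s) 0ℂ xs

infix 4 _∥_ _∥?_

_∥_ : ℕ⁺ → ℕ⁺ → Set
d ∥ n = val d ∣ val n × gcd (val d) (val n ℕ./ val d) ≡ 1

_∥?_ : ∀ d n → Dec (d ∥ n)
d ∥? n = (val d ∣? val n) ×-dec (gcd (val d) (val n ℕ./ val d) ℕ.≟ 1)

unitaryDivisors : ℕ⁺ → List ℕ⁺
unitaryDivisors n = filter (_∥? n) [1⋯ val n ]

ω : ℕ⁺ → ℕ
ω n = length (filter (λ p → prime? p ×-dec (p ∣? val n)) (upTo (suc (val n))))

μ* : ℕ⁺ → ℤ
μ* n = ℤ.-1ℤ ℤ.^ ω n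

μ*ₖ : ∀ {k} → Vec ℕ⁺ k → ℂ
μ*ₖ n = fromℤ (∏ℤ (Vec.map μ* n))

infixl 7 _⊠_

_⊠_ : ∀ {k} → (Vec ℕ⁺ k → ℂ) → (Vec ℕ⁺ k → ℂ) → Vec ℕ⁺ k → ℂ
(f ⊠ g) n = ∑ℂ (choices (Vec.map unitaryDivisors n)) λ d → f d *ℂ g (zipWith _÷_ n d)

-- The modified unitary Ramanujan sum c̃_q(n), by its explicit formula over
-- the d with d ∥ n and d ∥ q.
c̃ : ℕ⁺ → ℕ⁺ → ℤ
c̃ q n = ∑ℤ (filter (_∥? n) (unitaryDivisors q)) λ d → + val d ℤ.* μ* (q ÷ d)

Coprime? : ∀ {k} (m q : Vec ℕ⁺ k) → Dec (Pointwise.Pointwise (λ a b → gcd (val a) (val b) ≡ 1) m q)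
Coprime? = Pointwise.decidable λ a b → gcd (val a) (val b) ℕ.≟ 1

-- The partial sums of a multiple series range over rectangles
-- n₁ ≤ N₁, …, n_k ≤ N_k and the limit is taken as N₁, …, N_k tend to
-- infinity independently. Different Cauchy sequences may represent one
-- real, so "the series has sum s" is this relation, not an equation.

rectangle : ∀ {k} → Vec ℕ k → List (Vec ℕ⁺ k)
rectangle N = choices (Vec.map [1⋯_] N)

HasSumℝ : ∀ {k} → (Vec ℕ⁺ k → ℝ) → ℝ → Set
HasSumℝ f s = ∀ ε → 0ℚ ℚ.< ε → ∃ λ M → ∀ N → All (M ℕ.≤_) N →
  ∣ ∑ℝ (rectangle N) f -ℝ s ∣ℝ ≤ℝ fromℚ ε

HasSumℂ : ∀ {k} → (Vec ℕ⁺ k → ℂ) → ℂ → Set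
HasSumℂ f s = ∀ ε → 0ℚ ℚ.< ε → ∃ λ M → ∀ N → All (M ℕ.≤_) N →
  ∣ ∑ℂ (rectangle N) f -ℂ s ∣ℂ ≤ℝ fromℚ ε

-- For nonnegative terms this is the constructive reading of ∑ f < ∞.
Convergentℝ : ∀ {k} → (Vec ℕ⁺ k → ℝ) → Set
Convergentℝ f = ∃ (HasSumℝ f)

AbsolutelyConvergent : ∀ {k} → (Vec ℕ⁺ k → ℂ) → Set
AbsolutelyConvergent f = Convergentℝ λ n → ∣ f n ∣ℂ

weighted : ∀ {k} → (Vec ℕ⁺ k → ℂ) → Vec ℕ⁺ k → ℝ
weighted f n =
  fromℚ (+ (2 ℕ.^ Vec.sum (Vec.map ω n)) ℚ./ 1) *ℝ (∣ (μ*ₖ ⊠ f) n ∣ℂ /ℝ ∏⁺ n)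

-- The series over m defining the coefficient ã_q; the terms with some
-- (mᵢ, qᵢ) ≠ 1 are replaced by 0.
coefficientTerm : ∀ {k} → (Vec ℕ⁺ k → ℂ) → Vec ℕ⁺ k → Vec ℕ⁺ k → ℂ
coefficientTerm f q m = if does (Coprime? m q)
  then (μ*ₖ ⊠ f) (zipWith _*⁺_ m q) /ℂ ∏⁺ (zipWith _*⁺_ m q)
  else 0ℂ

expansionTerm : ∀ {k} → (Vec ℕ⁺ k → ℂ) → Vec ℕ⁺ k → Vec ℕ⁺ k → ℂ
expansionTerm ã n q = ã q *ℂ fromℤ (∏ℤ (zipWith c̃ q n))

{-# OPTIONS --safe #-}

-- Let g = μ*ₖ × f. Unitary Möbius inversion gives f(n) = ∑_{d ∥ n} g(d), and
-- since ∑_{q ∥ d} c̃_q(n) is d or 0 according to whether d ∥ n, this says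
-- f(n) = ∑_d (g(d) / d) ∑_{q ∥ d} c̃_q(n), where only d ∥ n contribute. Writing
-- d = m q with (m , q) = 1 and summing over m first turns it into
-- ∑_q ã_q c̃_q(n). The rearrangement is legitimate because c̃_q(n) is bounded in
-- q and d arises from exactly 2^ω(d) pairs (m , q), so that the terms with m q
-- outside a large box contribute little, uniformly in the finite set of pairs.
--
-- Real and imaginary parts are treated separately. All finite identities are
-- proved in ℚ, for the n-th members of the Cauchy sequences; only bounds on
-- tails pass to the limit.
module Submission where

open import Defs
open import Data.Bool.Base using (true; false; if_then_else_)
open import Data.Empty using (⊥; ⊥-elim)
open import Data.Integer.Base as ℤ using (ℤ)
import Data.Integer.Properties as ℤ
open import Data.Integer.Solver using () renaming (module +-*-Solver to ℤ-Solver)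
open import Data.List.Base using (List; []; _∷_; _++_; map; filter; length; concatMap; upTo)
open import Data.List.Membership.Propositional using (_∈_; _∉_)
import Data.List.Membership.Propositional.Properties as ∈
open import Data.List.Membership.Propositional.Properties.WithK using (unique∧set⇒bag)
import Data.List.Properties as List
open import Data.List.Relation.Binary.BagAndSetEquality using (∼bag⇒↭)
open import Data.List.Relation.Binary.Permutation.Propositional as Perm using (_↭_; prep; ↭-refl; ↭-trans)
import Data.List.Relation.Binary.Permutation.Propositional.Properties as ↭
import Data.List.Relation.Binary.Permutation.Setoid.Properties as ↭ₛ
open import Data.List.Relation.Binary.Subset.Propositional using (_⊆_)
import Data.List.Relation.Unary.All as ListAll
open import Data.List.Relation.Unary.Any using (here; there)
open import Data.List.Relation.Unary.Unique.Propositional using (Unique; []; _∷_)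
import Data.List.Relation.Unary.Unique.Propositional.Properties as Unique
open import Data.Nat.Base as ℕ using (ℕ; zero; suc; NonZero; s≤s)
open import Data.Nat.Coprimality as Coprime using (Coprime; 1-coprimeTo; coprime-divisor; coprime⇒gcd≡1; gcd≡1⇒coprime)
open import Data.Nat.Divisibility as ∣ using (_∣_; _∤_; _∣?_; divides; ∣-trans; ∣⇒≤; m∣m*n; n∣m*n; ∣m⇒∣m*n; ∣n⇒∣m*n)
open import Data.Nat.DivMod using (m*n/n≡m)
open import Data.Nat.GCD using (gcd)
open import Data.Nat.Primality using (Prime; prime?; euclidsLemma; prime⇒irreducible; prime⇒nonZero; prime⇒nonTrivial; ¬prime[1])
open import Data.Nat.Primality.Factorisation using (factorise)
import Data.Nat.Properties as ℕ
open import Data.Product.Base using (_×_; _,_; ∃; ∃₂; proj₁; proj₂)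
open import Data.Rational.Base as ℚ using (ℚ; 0ℚ; 1ℚ; ½; _+_; _*_; _-_; -_; _≤_; _<_; ∣_∣)
import Data.Rational.Properties as ℚ
open import Data.Rational.Solver using (module +-*-Solver)
import Data.Rational.Unnormalised.Base as ℚᵘ
import Data.Rational.Unnormalised.Properties as ℚᵘ
open import Data.Sum.Base using (_⊎_; inj₁; inj₂)
open import Data.Vec.Base as Vec using (Vec; []; _∷_; zipWith)
open import Data.Vec.Properties using (∷-injective)
open import Data.Vec.Relation.Binary.Pointwise.Inductive using (Pointwise; []; _∷_)
open import Data.Vec.Relation.Unary.All using (All; []; _∷_)
open import Function.Base using (_∘_)
open import Function.Bundles using (mk⇔)
open import Relation.Binary.PropositionalEquality as ≡ using (_≡_; _≢_; refl; sym; trans; cong; cong₂; subst; subst₂; setoid)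
open import Relation.Nullary.Decidable using (Dec; yes; no; does; _×-dec_; dec-true; dec-false)
open import Relation.Nullary.Negation using (¬_)

-- The obstacle is that a real number is a Cauchy sequence of rationals, and an infinite sum does
-- not act on it index by index: the `i`-th rational of `ã q` is not a sum of the `i`-th rationals
-- of its terms. Infinite rearrangement is therefore never carried out. Finite sums are compared
-- exactly at each index, and estimates hold from some index on that may depend on the lists summed
-- over. This fixes the order of choices in the final estimate: the box comes from the tail bound,
-- then an arbitrary rectangle of `q` is given, and only then is the range of `m` chosen, large
-- enough for that rectangle. Finite sums are reindexed by showing that two duplicate-free lists
-- have the same members. The count 2^ω(d) of unitary divisors and the vanishing of the sum of `μ*`
-- over them both come from splitting off the full power of one prime, which halves the set of
-- unitary divisors.

private variable
  A B : Set
  k : ℕ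

-- Lists without repetition

Unique-resp-↭ : {xs ys : List A} → xs ↭ ys → Unique xs → Unique ys
Unique-resp-↭ {A} p = ↭ₛ.Unique-resp-↭ (setoid A) (Perm.↭⇒↭ₛ p)

-- The device behind the reindexings below: for duplicate-free lists, a bijection of index sets
-- reduces to two inclusions, whatever the order of enumeration.
unique∧set⇒↭ : {xs ys : List A} → Unique xs → Unique ys → xs ⊆ ys → ys ⊆ xs → xs ↭ ys
unique∧set⇒↭ uxs uys xs⊆ys ys⊆xs = ∼bag⇒↭ (unique∧set⇒bag uxs uys (mk⇔ xs⊆ys ys⊆xs))

-- One occurrence of each member of `xs` is removed from `ys`. As `x` does not recur in `xs`,
-- removing it leaves the remaining members of `xs` inside `ys`.
complement : {xs ys : List A} → Unique xs → xs ⊆ ys → ∃ λ rs → ys ↭ xs ++ rs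
complement {xs = []}     {ys} _ _ = ys , ↭-refl
complement {xs = x ∷ xs} (x∉xs ∷ uxs) xs⊆ys
  with ps , qs , refl ← ∈.∈-∃++ (xs⊆ys (here refl)) =
  let rs , p = complement {ys = ps ++ qs} uxs λ y∈xs → drop y∈xs (∈.∈-++⁻ ps (xs⊆ys (there y∈xs)))
  in rs , ↭-trans (↭.shift x ps qs) (prep x p)
  where
  drop : ∀ {y} → y ∈ xs → _ → y ∈ ps ++ qs
  drop _    (inj₁ y∈ps)         = ∈.∈-++⁺ˡ y∈ps
  drop y∈xs (inj₂ (here refl))  = ⊥-elim (ListAll.lookup x∉xs y∈xs refl)
  drop _    (inj₂ (there y∈qs)) = ∈.∈-++⁺ʳ ps y∈qs

++-disjoint : {xs ys : List A} → Unique (xs ++ ys) → ∀ {x} → x ∈ ys → x ∉ xs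
++-disjoint {xs = x ∷ xs} (x∉ ∷ _) y∈ys (here refl)  = ListAll.lookup x∉ (∈.∈-++⁺ʳ xs y∈ys) refl
++-disjoint {xs = x ∷ xs} (_ ∷ u)  y∈ys (there y∈xs) = ++-disjoint u y∈ys y∈xs

++-uniqueʳ : (xs : List A) {ys : List A} → Unique (xs ++ ys) → Unique ys
++-uniqueʳ []       u       = u
++-uniqueʳ (_ ∷ xs) (_ ∷ u) = ++-uniqueʳ xs u

∈-remainder : {zs xs ys : List A} → zs ↭ xs ++ ys → ∀ {x} → x ∈ zs → x ∉ xs → x ∈ ys
∈-remainder {xs = xs} p x∈zs x∉xs with ∈.∈-++⁻ xs (↭.∈-resp-↭ p x∈zs)
... | inj₁ x∈xs = ⊥-elim (x∉xs x∈xs)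
... | inj₂ x∈ys = x∈ys

-- Injectivity is asked only on members, because division is injective only where it is exact; see
-- the use with `swap÷`.
map-unique : {f : A → B} {xs : List A} → (∀ {x y} → x ∈ xs → y ∈ xs → f x ≡ f y → x ≡ y) → Unique xs → Unique (map f xs)
map-unique inj [] = []
map-unique {f = f} {x ∷ xs} inj (x∉xs ∷ u) =
  ListAll.tabulate (λ fy∈ fx≡ → let y , y∈ , eq = ∈.∈-map⁻ f fy∈ in
    ListAll.lookup x∉xs y∈ (inj (here refl) (there y∈) (trans fx≡ eq))) ∷
  map-unique (λ y∈ z∈ → inj (there y∈) (there z∈)) u

pairs : List A → (A → List B) → List (A × B)
pairs xs f = concatMap (λ x → map (x ,_) (f x)) xs

∈-pairs⁺ : {xs : List A} {f : A → List B} {x : A} {y : B} → x ∈ xs → y ∈ f x → (x , y) ∈ pairs xs f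
∈-pairs⁺ {f = f} (here refl) y∈ = ∈.∈-++⁺ˡ (∈.∈-map⁺ (_ ,_) y∈)
∈-pairs⁺ {xs = x ∷ _} {f} (there x∈) y∈ = ∈.∈-++⁺ʳ (map (x ,_) (f x)) (∈-pairs⁺ {f = f} x∈ y∈)

∈-pairs⁻ : (xs : List A) (f : A → List B) {x : A} {y : B} → (x , y) ∈ pairs xs f → x ∈ xs × y ∈ f x
∈-pairs⁻ (x ∷ xs) f p with ∈.∈-++⁻ (map (x ,_) (f x)) p
... | inj₁ q with _ , y∈ , refl ← ∈.∈-map⁻ (x ,_) q = here refl , y∈
... | inj₂ q with x∈ , y∈ ← ∈-pairs⁻ xs f q = there x∈ , y∈

pairs-unique : {xs : List A} {f : A → List B} → Unique xs → (∀ x → Unique (f x)) → Unique (pairs xs f)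
pairs-unique [] _ = []
pairs-unique {xs = x ∷ xs} {f} (x∉xs ∷ u) uf = Unique.++⁺ (Unique.map⁺ (cong proj₂) (uf x)) (pairs-unique u uf) disjoint
  where
  disjoint : ∀ {v} → v ∈ map (x ,_) (f x) × v ∈ pairs xs f → _
  disjoint (p , q) with _ , _ , refl ← ∈.∈-map⁻ (x ,_) p =
    ListAll.lookup x∉xs (proj₁ (∈-pairs⁻ xs f q)) refl

-- Finite sums in ℚ

∑ℚ : List A → (A → ℚ) → ℚ
∑ℚ []       f = 0ℚ
∑ℚ (x ∷ xs) f = f x + ∑ℚ xs f

∑ℚ-cong : (xs : List A) {f g : A → ℚ} → (∀ {x} → x ∈ xs → f x ≡ g x) → ∑ℚ xs f ≡ ∑ℚ xs g
∑ℚ-cong []       _ = refl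
∑ℚ-cong (_ ∷ xs) h = cong₂ _+_ (h (here refl)) (∑ℚ-cong xs (h ∘ there))

∑ℚ-++ : (xs : List A) {ys : List A} {f : A → ℚ} → ∑ℚ (xs ++ ys) f ≡ ∑ℚ xs f + ∑ℚ ys f
∑ℚ-++ []       {ys} {f} = sym (ℚ.+-identityˡ (∑ℚ ys f))
∑ℚ-++ (x ∷ xs) {ys} {f} = trans (cong (f x +_) (∑ℚ-++ xs)) (sym (ℚ.+-assoc (f x) (∑ℚ xs f) (∑ℚ ys f)))

∑ℚ-map : (xs : List A) {g : A → B} {f : B → ℚ} → ∑ℚ (map g xs) f ≡ ∑ℚ xs (f ∘ g)
∑ℚ-map []                = refl
∑ℚ-map (x ∷ xs) {g} {f} = cong (f (g x) +_) (∑ℚ-map xs)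

∑ℚ-pairs : (xs : List A) {ys : A → List B} {f : A × B → ℚ} →
  ∑ℚ (pairs xs ys) f ≡ ∑ℚ xs λ x → ∑ℚ (ys x) λ y → f (x , y)
∑ℚ-pairs []            = refl
∑ℚ-pairs (x ∷ xs) {ys} = trans (∑ℚ-++ (map (x ,_) (ys x))) (cong₂ _+_ (∑ℚ-map (ys x)) (∑ℚ-pairs xs))

∑ℚ-↭ : {xs ys : List A} {f : A → ℚ} → xs ↭ ys → ∑ℚ xs f ≡ ∑ℚ ys f
∑ℚ-↭ Perm.refl = refl
∑ℚ-↭ {f = f} (prep x p) = cong (f x +_) (∑ℚ-↭ p)
∑ℚ-↭ {f = f} (Perm.swap {xs} {ys} x y p) = trans (cong (λ t → f x + (f y + t)) (∑ℚ-↭ p))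
  (solve 3 (λ a b c → a :+ (b :+ c) := b :+ (a :+ c)) refl (f x) (f y) (∑ℚ ys f))
  where open +-*-Solver
∑ℚ-↭ (Perm.trans p q) = trans (∑ℚ-↭ p) (∑ℚ-↭ q)

∑ℚ-zero : (xs : List A) {f : A → ℚ} → (∀ {x} → x ∈ xs → f x ≡ 0ℚ) → ∑ℚ xs f ≡ 0ℚ
∑ℚ-zero []       _ = refl
∑ℚ-zero (_ ∷ xs) h = cong₂ _+_ (h (here refl)) (∑ℚ-zero xs (h ∘ there))

∑ℚ-+ : (xs : List A) {f g : A → ℚ} → ∑ℚ xs (λ x → f x + g x) ≡ ∑ℚ xs f + ∑ℚ xs g
∑ℚ-+ []               = refl
∑ℚ-+ (x ∷ xs) {f} {g} = trans (cong (λ t → f x + g x + t) (∑ℚ-+ xs))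
  (solve 4 (λ a b c d → a :+ b :+ (c :+ d) := a :+ c :+ (b :+ d)) refl (f x) (g x) (∑ℚ xs f) (∑ℚ xs g))
  where open +-*-Solver

∑ℚ-*ˡ : (c : ℚ) (xs : List A) {f : A → ℚ} → ∑ℚ xs (λ x → c * f x) ≡ c * ∑ℚ xs f
∑ℚ-*ˡ c []           = sym (ℚ.*-zeroʳ c)
∑ℚ-*ˡ c (x ∷ xs) {f} = trans (cong (c * f x +_) (∑ℚ-*ˡ c xs)) (sym (ℚ.*-distribˡ-+ c (f x) (∑ℚ xs f)))

∑ℚ-neg : (xs : List A) {f : A → ℚ} → ∑ℚ xs (λ x → - f x) ≡ - ∑ℚ xs f
∑ℚ-neg []           = refl
∑ℚ-neg (x ∷ xs) {f} = trans (cong (- f x +_) (∑ℚ-neg xs)) (sym (ℚ.neg-distrib-+ (f x) (∑ℚ xs f)))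

∑ℚ-swap : (xs : List A) (ys : List B) {f : A → B → ℚ} →
  ∑ℚ xs (λ x → ∑ℚ ys (f x)) ≡ ∑ℚ ys λ y → ∑ℚ xs λ x → f x y
∑ℚ-swap []       ys     = sym (∑ℚ-zero ys λ _ → refl)
∑ℚ-swap (x ∷ xs) ys {f} = trans (cong (∑ℚ ys (f x) +_) (∑ℚ-swap xs ys)) (sym (∑ℚ-+ ys))

∑ℚ-mono : (xs : List A) {f g : A → ℚ} → (∀ {x} → x ∈ xs → f x ≤ g x) → ∑ℚ xs f ≤ ∑ℚ xs g
∑ℚ-mono []       _ = ℚ.≤-refl
∑ℚ-mono (_ ∷ xs) h = ℚ.+-mono-≤ (h (here refl)) (∑ℚ-mono xs (h ∘ there))

∑ℚ-nonneg : (xs : List A) {f : A → ℚ} → (∀ x → 0ℚ ≤ f x) → 0ℚ ≤ ∑ℚ xs f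
∑ℚ-nonneg []       _ = ℚ.≤-refl
∑ℚ-nonneg (x ∷ xs) {f} h = ℚ.+-mono-≤ {0ℚ} {f x} {0ℚ} {∑ℚ xs f} (h x) (∑ℚ-nonneg xs h)

∣∑ℚ∣≤ : (xs : List A) {f : A → ℚ} → ∣ ∑ℚ xs f ∣ ≤ ∑ℚ xs λ x → ∣ f x ∣
∣∑ℚ∣≤ []           = ℚ.≤-refl {0ℚ}
∣∑ℚ∣≤ (x ∷ xs) {f} = ℚ.≤-trans (ℚ.∣p+q∣≤∣p∣+∣q∣ (f x) (∑ℚ xs f)) (ℚ.+-monoʳ-≤ ∣ f x ∣ (∣∑ℚ∣≤ xs))

∑ℚ-⊆ : {xs ys : List A} {f : A → ℚ} → Unique xs → xs ⊆ ys → (∀ x → 0ℚ ≤ f x) → ∑ℚ xs f ≤ ∑ℚ ys f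
∑ℚ-⊆ {xs = xs} {ys} {f} u xs⊆ys 0≤f with rs , p ← complement u xs⊆ys = begin
  ∑ℚ xs f              ≡⟨ ℚ.+-identityʳ (∑ℚ xs f) ⟨
  ∑ℚ xs f + 0ℚ         ≤⟨ ℚ.+-monoʳ-≤ (∑ℚ xs f) (∑ℚ-nonneg rs 0≤f) ⟩
  ∑ℚ xs f + ∑ℚ rs f    ≡⟨ ∑ℚ-++ xs ⟨
  ∑ℚ (xs ++ rs) f      ≡⟨ ∑ℚ-↭ p ⟨
  ∑ℚ ys f              ∎
  where open ℚ.≤-Reasoning

∑ℚ-filter : {P : A → Set} (P? : ∀ x → Dec (P x)) (xs : List A) {f : A → ℚ} →
  ∑ℚ (filter P? xs) f ≡ ∑ℚ xs λ x → if does (P? x) then f x else 0ℚ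
∑ℚ-filter P? []           = refl
∑ℚ-filter P? (x ∷ xs) {f} with does (P? x)
... | true  = cong (f x +_) (∑ℚ-filter P? xs)
... | false = trans (∑ℚ-filter P? xs) (sym (ℚ.+-identityˡ _))

∑ℚ-single : {xs : List A} {f : A → ℚ} {a : A} → Unique xs → a ∈ xs → (∀ {x} → x ∈ xs → x ≢ a → f x ≡ 0ℚ) → ∑ℚ xs f ≡ f a
∑ℚ-single {xs = x ∷ xs} {f} (x∉xs ∷ _) (here refl) h =
  trans (cong (f x +_) (∑ℚ-zero xs λ y∈ → h (there y∈) (ListAll.lookup x∉xs y∈ ∘ sym))) (ℚ.+-identityʳ (f x))
∑ℚ-single {xs = x ∷ xs} {f} {a} (x∉xs ∷ u) (there a∈) h =
  trans (cong₂ _+_ (h (here refl) (ListAll.lookup x∉xs a∈)) (∑ℚ-single u a∈ (h ∘ there))) (ℚ.+-identityˡ (f a))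

-- Integers and reciprocals in ℚ

⌜_⌝ : ℤ → ℚ
⌜ z ⌝ = z ℚ./ 1

toℚᵘ-/ : ∀ z n → ℚ.toℚᵘ (z ℚ./ suc n) ℚᵘ.≃ ℚᵘ.mkℚᵘ z n
toℚᵘ-/ z n = ℚ.toℚᵘ-fromℚᵘ (ℚᵘ.mkℚᵘ z n)

⌜⌝-+ : ∀ a b → ⌜ a ℤ.+ b ⌝ ≡ ⌜ a ⌝ + ⌜ b ⌝
⌜⌝-+ a b = ℚ.toℚᵘ-injective (begin
  ℚ.toℚᵘ ⌜ a ℤ.+ b ⌝                  ≈⟨ toℚᵘ-/ (a ℤ.+ b) 0 ⟩
  ℚᵘ.mkℚᵘ (a ℤ.+ b) 0                 ≈⟨ ℚᵘ.*≡* (ℤ-Solver.solve 2 (λ a b → (a :+ b) :* con (ℤ.+ 1) := (a :* con (ℤ.+ 1) :+ b :* con (ℤ.+ 1)) :* con (ℤ.+ 1)) refl a b) ⟩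
  ℚᵘ.mkℚᵘ a 0 ℚᵘ.+ ℚᵘ.mkℚᵘ b 0        ≈⟨ ℚᵘ.+-cong (toℚᵘ-/ a 0) (toℚᵘ-/ b 0) ⟨
  ℚ.toℚᵘ ⌜ a ⌝ ℚᵘ.+ ℚ.toℚᵘ ⌜ b ⌝      ≈⟨ ℚ.toℚᵘ-homo-+ ⌜ a ⌝ ⌜ b ⌝ ⟨
  ℚ.toℚᵘ (⌜ a ⌝ + ⌜ b ⌝)              ∎)
  where
  open import Relation.Binary.Reasoning.Setoid ℚᵘ.≃-setoid
  open ℤ-Solver

⌜⌝-* : ∀ a b → ⌜ a ℤ.* b ⌝ ≡ ⌜ a ⌝ * ⌜ b ⌝
⌜⌝-* a b = ℚ.toℚᵘ-injective (begin
  ℚ.toℚᵘ ⌜ a ℤ.* b ⌝                  ≈⟨ toℚᵘ-/ (a ℤ.* b) 0 ⟩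
  ℚᵘ.mkℚᵘ a 0 ℚᵘ.* ℚᵘ.mkℚᵘ b 0        ≈⟨ ℚᵘ.*-cong (toℚᵘ-/ a 0) (toℚᵘ-/ b 0) ⟨
  ℚ.toℚᵘ ⌜ a ⌝ ℚᵘ.* ℚ.toℚᵘ ⌜ b ⌝      ≈⟨ ℚ.toℚᵘ-homo-* ⌜ a ⌝ ⌜ b ⌝ ⟨
  ℚ.toℚᵘ (⌜ a ⌝ * ⌜ b ⌝)              ∎)
  where open import Relation.Binary.Reasoning.Setoid ℚᵘ.≃-setoid

⌜⌝-neg : ∀ a → ⌜ ℤ.- a ⌝ ≡ - ⌜ a ⌝
⌜⌝-neg a = trans (cong ⌜_⌝ (sym (ℤ.-1*i≡-i a))) (trans (⌜⌝-* ℤ.-1ℤ a) (solve 1 (λ x → con (- 1ℚ) :* x := :- x) refl ⌜ a ⌝))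
  where open +-*-Solver

0≤⌜+⌝ : ∀ n → 0ℚ ≤ ⌜ ℤ.+ n ⌝
0≤⌜+⌝ n = 0≤ι n 0

0<⌜+suc⌝ : ∀ n → 0ℚ < ⌜ ℤ.+ suc n ⌝
0<⌜+suc⌝ n = ℚ.positive⁻¹ ⌜ ℤ.+ suc n ⌝ {{ℚ.normalize-pos (suc n) 1}}

⌜⌝-∑ℤ : (xs : List A) {f : A → ℤ} → ⌜ ∑ℤ xs f ⌝ ≡ ∑ℚ xs (⌜_⌝ ∘ f)
⌜⌝-∑ℤ []           = refl
⌜⌝-∑ℤ (x ∷ xs) {f} = trans (⌜⌝-+ (f x) (∑ℤ xs f)) (cong (⌜ f x ⌝ +_) (⌜⌝-∑ℤ xs {f}))

∑ℚ-1 : (xs : List A) → ∑ℚ xs (λ _ → 1ℚ) ≡ ⌜ ℤ.+ length xs ⌝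
∑ℚ-1 []       = refl
∑ℚ-1 (_ ∷ xs) = trans (cong (λ t → 1ℚ + t) (∑ℚ-1 xs)) (sym (⌜⌝-+ (ℤ.+ 1) (ℤ.+ length xs)))

∑ℚ-const : (xs : List A) (c : ℚ) → ∑ℚ xs (λ _ → c) ≡ ⌜ ℤ.+ length xs ⌝ * c
∑ℚ-const xs c = trans (∑ℚ-cong xs {g = λ _ → c * 1ℚ} λ _ → sym (ℚ.*-identityʳ c)) (trans (∑ℚ-*ˡ c xs) (trans (cong (c *_) (∑ℚ-1 xs)) (ℚ.*-comm c ⌜ ℤ.+ length xs ⌝)))

-- The factor by which _/ℝ_ and _/ℂ_ multiply.
recip : ℕ⁺ → ℚ
recip n = ℤ.+ 1 ℚ./ val n

0≤recip : ∀ n → 0ℚ ≤ recip n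
0≤recip n = 0≤ι 1 (ℕ⁺.pred n)

recip-inverse : ∀ n → ⌜ ℤ.+ val n ⌝ * recip n ≡ 1ℚ
recip-inverse n = ℚ.toℚᵘ-injective (begin
  ℚ.toℚᵘ (⌜ ℤ.+ val n ⌝ * recip n)                         ≈⟨ ℚ.toℚᵘ-homo-* ⌜ ℤ.+ val n ⌝ (recip n) ⟩
  ℚ.toℚᵘ ⌜ ℤ.+ val n ⌝ ℚᵘ.* ℚ.toℚᵘ (recip n)               ≈⟨ ℚᵘ.*-cong (toℚᵘ-/ (ℤ.+ val n) 0) (toℚᵘ-/ (ℤ.+ 1) (ℕ⁺.pred n)) ⟩
  ℚᵘ.mkℚᵘ (ℤ.+ val n) 0 ℚᵘ.* ℚᵘ.mkℚᵘ (ℤ.+ 1) (ℕ⁺.pred n)     ≈⟨ ℚᵘ.*≡* (ℤ-Solver.solve 1 (λ x → x :* con (ℤ.+ 1) :* con (ℤ.+ 1) := con (ℤ.+ 1) :* (con (ℤ.+ 1) :* x)) refl (ℤ.+ val n)) ⟩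
  ℚᵘ.mkℚᵘ (ℤ.+ 1) 0                                        ∎)
  where
  open import Relation.Binary.Reasoning.Setoid ℚᵘ.≃-setoid
  open ℤ-Solver

-- Inverses are unique: multiply by m (1/m) and n (1/n), then cancel the product mn against its own
-- reciprocal.
recip-* : ∀ m n → recip (m *⁺ n) ≡ recip m * recip n
recip-* m n = begin
  r                                                 ≡⟨ solve 1 (λ r → r := r :* con 1ℚ :* con 1ℚ) refl r ⟩
  r * 1ℚ * 1ℚ                                       ≡⟨ cong₂ (λ s t → r * s * t) (recip-inverse m) (recip-inverse n) ⟨
  r * (M * recip m) * (N * recip n)                 ≡⟨ solve 5 (λ r m m′ n n′ → r :* (m :* m′) :* (n :* n′) := m :* n :* r :* (m′ :* n′)) refl r M (recip m) N (recip n) ⟩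
  M * N * r * (recip m * recip n)                   ≡⟨ cong (λ t → t * r * (recip m * recip n)) (trans (cong ⌜_⌝ (ℤ.pos-* (val m) (val n))) (⌜⌝-* (ℤ.+ val m) (ℤ.+ val n))) ⟨
  ⌜ ℤ.+ val (m *⁺ n) ⌝ * r * (recip m * recip n)      ≡⟨ cong (_* (recip m * recip n)) (recip-inverse (m *⁺ n)) ⟩
  1ℚ * (recip m * recip n)                          ≡⟨ ℚ.*-identityˡ _ ⟩
  recip m * recip n                                 ∎
  where
  open ≡.≡-Reasoning
  open +-*-Solver
  r = recip (m *⁺ n)
  M = ⌜ ℤ.+ val m ⌝
  N = ⌜ ℤ.+ val n ⌝

-- Unitary divisors

val-injective : ∀ {m n} → val m ≡ val n → m ≡ n
val-injective = cong (λ v → 1+ ℕ.pred v)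

*⁺-comm : ∀ m n → m *⁺ n ≡ n *⁺ m
*⁺-comm m n = val-injective (ℕ.*-comm (val m) (val n))

*⁺-assoc : ∀ l m n → (l *⁺ m) *⁺ n ≡ l *⁺ (m *⁺ n)
*⁺-assoc l m n = val-injective (ℕ.*-assoc (val l) (val m) (val n))

*⁺-cancelˡ : ∀ l {m n} → l *⁺ m ≡ l *⁺ n → m ≡ n
*⁺-cancelˡ l {m} {n} eq = val-injective (ℕ.*-cancelˡ-≡ (val m) (val n) (val l) (cong val eq))

*⁺-swapˡ : ∀ l m n → l *⁺ (m *⁺ n) ≡ m *⁺ (l *⁺ n)
*⁺-swapˡ l m n = trans (sym (*⁺-assoc l m n)) (trans (cong (_*⁺ n) (*⁺-comm l m)) (*⁺-assoc m l n))

-- A common divisor of `a` and `b c` divides `a`, so it is coprime to `b` and must divide `c`.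
coprime-*ʳ : ∀ {a b c} → Coprime a b → Coprime a c → Coprime a (b ℕ.* c)
coprime-*ʳ {a} {b} a⊥b a⊥c {d} (d∣a , d∣bc) = a⊥c (d∣a , coprime-divisor d⊥b d∣bc)
  where
  d⊥b : Coprime d b
  d⊥b (e∣d , e∣b) = a⊥b (∣-trans e∣d d∣a , e∣b)

coprime-∣ : ∀ {a b c d} → a ∣ c → b ∣ d → Coprime c d → Coprime a b
coprime-∣ a∣c b∣d c⊥d (e∣a , e∣b) = c⊥d (∣-trans e∣a a∣c , ∣-trans e∣b b∣d)

-- Unitary divisibility without division: the codivisor is explicit and the relation is symmetric in
-- `d` and `e`, so junk values of `÷` never arise.
record Split (d e n : ℕ⁺) : Set where
  constructor split
  field
    product : d *⁺ e ≡ n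
    coprime : Coprime (val d) (val e)

open Split

/-unique : ∀ d {e n} → d *⁺ e ≡ n → val n ℕ./ val d ≡ val e
/-unique d {e} refl = trans (cong (ℕ._/ val d) (ℕ.*-comm (val d) (val e))) (m*n/n≡m (val e) (val d))

÷-unique : ∀ d {e n} → d *⁺ e ≡ n → n ÷ d ≡ e
÷-unique d eq = cong (λ q → 1+ ℕ.pred q) (/-unique d eq)

Split⇒∥ : ∀ {d e n} → Split d e n → d ∥ n
Split⇒∥ {d} {e} (split eq d⊥e) =
  divides (val e) (trans (cong val (sym eq)) (ℕ.*-comm (val d) (val e))) ,
  trans (cong (gcd (val d)) (/-unique d eq)) (coprime⇒gcd≡1 d⊥e)

∥⇒Split : ∀ d {n} → d ∥ n → Split d (n ÷ d) n
∥⇒Split d (divides zero () , _)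
∥⇒Split d {n} (divides (suc q) eq , g) =
  subst (λ e → Split d e n) (sym (÷-unique d d*e≡n))
    (split d*e≡n (gcd≡1⇒coprime (trans (cong (gcd (val d)) (sym (/-unique d d*e≡n))) g)))
  where
  d*e≡n : d *⁺ (1+ q) ≡ n
  d*e≡n = val-injective (trans (ℕ.*-comm (val d) (suc q)) (sym eq))

Split-÷ : ∀ {d e n} → Split d e n → n ÷ d ≡ e
Split-÷ {d} s = ÷-unique d (product s)

Split-sym : ∀ {d e n} → Split d e n → Split e d n
Split-sym {d} {e} (split eq d⊥e) = split (trans (*⁺-comm e d) eq) (Coprime.sym d⊥e)

-- With `Split-assocˡ` this rebrackets a factorisation n = e t s into pairwise coprime factors, the
-- bijection used in `∑-regroup`.
Split-assocʳ : ∀ {d e s t n} → Split d s n → Split e t d → Split e (t *⁺ s) n × Split t s (t *⁺ s)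
Split-assocʳ {e = e} {s} {t} (split refl d⊥s) (split refl e⊥t) =
  split (sym (*⁺-assoc e t s)) (coprime-*ʳ {val e} {val t} {val s} e⊥t (coprime-∣ (m∣m*n (val t)) ∣.∣-refl d⊥s)) ,
  split refl (coprime-∣ (n∣m*n (val e)) ∣.∣-refl d⊥s)

Split-assocˡ : ∀ {e r s t n} → Split e r n → Split t s r → Split e t (e *⁺ t) × Split (e *⁺ t) s n
Split-assocˡ {e} {s = s} {t} (split refl e⊥r) (split refl t⊥s) =
  split refl (coprime-∣ ∣.∣-refl (m∣m*n (val s)) e⊥r) ,
  split (*⁺-assoc e t s) (Coprime.sym (coprime-*ʳ {val s} {val e} {val t} (Coprime.sym (coprime-∣ ∣.∣-refl (n∣m*n (val t)) e⊥r)) (Coprime.sym t⊥s)))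

[1⋯]⁺ : ∀ {d n} → val d ℕ.≤ n → d ∈ [1⋯ n ]
[1⋯]⁺ d≤n = ∈.∈-map⁺ 1+_ (∈.∈-upTo⁺ d≤n)

[1⋯]⁻ : ∀ {d n} → d ∈ [1⋯ n ] → val d ℕ.≤ n
[1⋯]⁻ d∈ with _ , i∈ , refl ← ∈.∈-map⁻ 1+_ d∈ = ∈.∈-upTo⁻ i∈

[1⋯]-unique : ∀ n → Unique [1⋯ n ]
[1⋯]-unique n = Unique.map⁺ (cong ℕ⁺.pred) (Unique.upTo⁺ n)

ud⁺ : ∀ {d e n} → Split d e n → d ∈ unitaryDivisors n
ud⁺ {n = n} s = let d∥n = Split⇒∥ s in ∈.∈-filter⁺ (_∥? n) ([1⋯]⁺ (∣⇒≤ (proj₁ d∥n))) d∥n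

ud⁻ : ∀ n {d} → d ∈ unitaryDivisors n → Split d (n ÷ d) n
ud⁻ n {d} d∈ = ∥⇒Split d (proj₂ (∈.∈-filter⁻ (_∥? n) {xs = [1⋯ val n ]} d∈))

ud-unique : ∀ n → Unique (unitaryDivisors n)
ud-unique n = Unique.filter⁺ (_∥? n) ([1⋯]-unique (val n))

-- Passing to the codivisor is an involution on unitary divisors; both sides run over the same
-- ordered pairs of complementary divisors.
∑-reflect : ∀ n (F : ℕ⁺ → ℕ⁺ → ℚ) →
  ∑ℚ (unitaryDivisors n) (λ d → F d (n ÷ d)) ≡ ∑ℚ (unitaryDivisors n) λ d → F (n ÷ d) d
∑-reflect n F = trans (sym (∑ℚ-map (unitaryDivisors n) {λ d → d , n ÷ d} {λ (d , e) → F d e}))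
  (trans (∑ℚ-↭ l↭r) (∑ℚ-map (unitaryDivisors n)))
  where
  l = map (λ d → d , n ÷ d) (unitaryDivisors n)
  r = map (λ d → n ÷ d , d) (unitaryDivisors n)
  l⊆r : l ⊆ r
  l⊆r {x} x∈ with d , d∈ , refl ← ∈.∈-map⁻ (λ d → d , n ÷ d) x∈ =
    let s = Split-sym (ud⁻ n d∈) in
    subst (λ d′ → (d′ , n ÷ d) ∈ r) (Split-÷ s) (∈.∈-map⁺ (λ d → n ÷ d , d) (ud⁺ s))
  r⊆l : r ⊆ l
  r⊆l {x} x∈ with d , d∈ , refl ← ∈.∈-map⁻ (λ d → n ÷ d , d) x∈ =
    let s = Split-sym (ud⁻ n d∈) in
    subst (λ d′ → (n ÷ d , d′) ∈ l) (Split-÷ s) (∈.∈-map⁺ (λ d → d , n ÷ d) (ud⁺ s))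
  l↭r : l ↭ r
  l↭r = unique∧set⇒↭ (Unique.map⁺ (cong proj₁) (ud-unique n)) (Unique.map⁺ (cong proj₂) (ud-unique n)) l⊆r r⊆l

-- Both sides run over the factorisations n = e t s into pairwise coprime factors, the left grouping
-- by d = e t and the right by `e`.
∑-regroup : ∀ n (F : ℕ⁺ → ℕ⁺ → ℚ) →
  ∑ℚ (unitaryDivisors n) (λ d → ∑ℚ (unitaryDivisors d) λ e → F e (d ÷ e)) ≡
  ∑ℚ (unitaryDivisors n) λ e → ∑ℚ (unitaryDivisors (n ÷ e)) λ t → F e t
∑-regroup n F = trans (sym (∑ℚ-pairs U)) (trans (sym (∑ℚ-map P {f} {G})) (trans (∑ℚ-↭ (unique∧set⇒↭ uˡ uʳ l⊆r r⊆l)) (trans (∑ℚ-map Q {g} {G}) (∑ℚ-pairs U))))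
  where
  U = unitaryDivisors n
  P = pairs U unitaryDivisors
  Q = pairs U (unitaryDivisors ∘ (n ÷_))
  G : ℕ⁺ × ℕ⁺ × ℕ⁺ → ℚ
  G (_ , e , t) = F e t
  -- The product is kept as a redundant first component so that both maps are injective by
  -- projection alone.
  f g : ℕ⁺ × ℕ⁺ → ℕ⁺ × ℕ⁺ × ℕ⁺
  f (d , e) = d , e , d ÷ e
  g (e , t) = e *⁺ t , e , t
  uˡ : Unique (map f P)
  uˡ = Unique.map⁺ (λ eq → cong₂ _,_ (cong proj₁ eq) (cong (proj₁ ∘ proj₂) eq)) (pairs-unique (ud-unique n) ud-unique)
  uʳ : Unique (map g Q)
  uʳ = Unique.map⁺ (cong proj₂) (pairs-unique (ud-unique n) (λ e → ud-unique (n ÷ e)))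
  l⊆r : map f P ⊆ map g Q
  l⊆r {x} x∈
    with (d , e) , de∈ , refl ← ∈.∈-map⁻ f {xs = P} x∈
    with d∈ , e∈ ← ∈-pairs⁻ U unitaryDivisors de∈
    with s₁ , s₂ ← Split-assocʳ (ud⁻ n d∈) (ud⁻ d e∈) =
    subst (λ d′ → (d′ , e , d ÷ e) ∈ map g Q) (product (ud⁻ d e∈))
      (∈.∈-map⁺ g (∈-pairs⁺ {f = unitaryDivisors ∘ (n ÷_)} (ud⁺ s₁) (subst (λ r → d ÷ e ∈ unitaryDivisors r) (sym (Split-÷ s₁)) (ud⁺ s₂))))
  r⊆l : map g Q ⊆ map f P
  r⊆l {x} x∈
    with (e , t) , et∈ , refl ← ∈.∈-map⁻ g {xs = Q} x∈
    with e∈ , t∈ ← ∈-pairs⁻ U (unitaryDivisors ∘ (n ÷_)) et∈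
    with s₁ , s₂ ← Split-assocˡ (ud⁻ n e∈) (ud⁻ (n ÷ e) t∈) =
    subst (λ t′ → (e *⁺ t , e , t′) ∈ map f P) (Split-÷ s₁)
      (∈.∈-map⁺ f (∈-pairs⁺ {f = unitaryDivisors} (ud⁺ s₂) (ud⁺ s₁)))

-- Splitting off a prime power

prime-coprime : ∀ {p t} → Prime p → p ∤ t → Coprime p t
prime-coprime pr p∤t (d∣p , d∣t) with prime⇒irreducible pr d∣p
... | inj₁ d≡1  = d≡1
... | inj₂ refl = ⊥-elim (p∤t d∣t)

-- u plays the role of the power pᵃ ∥ m of a prime p ∣ m.
record PrimePart (m : ℕ⁺) : Set where
  field
    {p}   : ℕ
    u m′  : ℕ⁺
    prime : Prime p
    p∣u   : p ∣ val u
    p∤m′  : p ∤ val m′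
    u⊥    : ∀ {t} → p ∤ t → Coprime (val u) t
    u*m′  : u *⁺ m′ ≡ m

-- Division by `p` is repeated while it succeeds, with `b` as fuel for the recursion. Coprimality to
-- everything `p` does not divide survives multiplication of `u` by `p`, so no exponent needs to be
-- tracked.
extract : ∀ {p} → Prime p → ∀ b m → val m ℕ.≤ b →
  ∃₂ λ u m′ → p ∤ val m′ × (∀ {t} → p ∤ t → Coprime (val u) t) × u *⁺ m′ ≡ m
extract {p} pr (suc b) m m≤b with p ∣? val m
... | no p∤m = 1⁺ , m , p∤m , (λ {t} _ → 1-coprimeTo t) , val-injective (ℕ.*-identityˡ (val m))
... | yes (divides zero ())
... | yes (divides (suc q) eq) =
  let instance _ = prime⇒nonZero pr
               _ = prime⇒nonTrivial pr
      P : ℕ⁺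
      P = 1+ ℕ.pred p
      P≡p : val P ≡ p
      P≡p = ℕ.suc-pred p
      q<m = subst (suc q ℕ.<_) (sym eq) (ℕ.m<m*n (suc q) p (ℕ.nonTrivial⇒n>1 p))
      u , m′ , p∤m′ , u⊥ , um′ = extract pr b (1+ q) (ℕ.≤-pred (ℕ.≤-trans q<m m≤b))
  in P *⁺ u , m′ , p∤m′ ,
     (λ {t} p∤t → Coprime.sym (coprime-*ʳ {t} {val P} {val u}
        (Coprime.sym (subst (λ x → Coprime x t) (sym P≡p) (prime-coprime pr p∤t)))
        (Coprime.sym (u⊥ p∤t)))) ,
     trans (*⁺-assoc P u m′) (trans (cong (P *⁺_) um′)
       (val-injective (trans (cong (ℕ._* suc q) P≡p) (trans (ℕ.*-comm p (suc q)) (sym eq)))))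

primePart : ∀ {m} → m ≢ 1⁺ → PrimePart m
primePart {m} m≢1 with factorise (val m)
... | record { factors = []    ; isFactorisation = eq } = ⊥-elim (m≢1 (val-injective eq))
... | record { factors = p ∷ ps ; isFactorisation = eq ; factorsPrime = pr ListAll.∷ _ } =
  let u , m′ , p∤m′ , u⊥ , um′ = extract pr (val m) m ℕ.≤-refl
      p∣m : p ∣ val m
      p∣m = subst (p ∣_) (sym eq) (m∣m*n _)
  in record { u = u ; m′ = m′ ; prime = pr ; p∤m′ = p∤m′ ; u⊥ = u⊥ ; u*m′ = um′
            ; p∣u = case-p (euclidsLemma (val u) (val m′) pr (subst (p ∣_) (sym (cong val um′)) p∣m)) p∤m′ }
  where
  case-p : ∀ {A B : Set} → A ⊎ B → (B → ⊥) → A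
  case-p (inj₁ a) _  = a
  case-p (inj₂ b) ¬b = ⊥-elim (¬b b)

primeDivisors : ℕ⁺ → List ℕ
primeDivisors n = filter (λ p → prime? p ×-dec (p ∣? val n)) (upTo (suc (val n)))

module _ {m} (m-part : PrimePart m) where
  open PrimePart m-part

  p∤ : ∀ {t} → t ∈ unitaryDivisors m′ → p ∤ val t
  p∤ {t} t∈ p∣t = p∤m′ (∣-trans p∣t (subst (val t ∣_) (cong val (product (ud⁻ m′ t∈))) (m∣m*n (val (m′ ÷ t)))))

  ω-step : ∀ {t} → p ∤ val t → ω (u *⁺ t) ≡ suc (ω t)
  ω-step {t} p∤t = ↭.↭-length (unique∧set⇒↭ {xs = primeDivisors (u *⁺ t)} {p ∷ primeDivisors t} (unq (u *⁺ t)) (ListAll.tabulate fresh ∷ unq t) l⊆r r⊆l)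
    where
    unq : ∀ n → Unique (primeDivisors n)
    unq n = Unique.filter⁺ (λ p → prime? p ×-dec (p ∣? val n)) (Unique.upTo⁺ (suc (val n)))
    elim : ∀ {n r} → r ∈ primeDivisors n → Prime r × r ∣ val n
    elim {n} r∈ = proj₂ (∈.∈-filter⁻ (λ p → prime? p ×-dec (p ∣? val n)) {xs = upTo (suc (val n))} r∈)
    intro : ∀ {n r} → Prime r → r ∣ val n → r ∈ primeDivisors n
    intro {n} pr r∣n = ∈.∈-filter⁺ (λ p → prime? p ×-dec (p ∣? val n)) (∈.∈-upTo⁺ (s≤s (∣⇒≤ r∣n))) (pr , r∣n)
    fresh : ∀ {r} → r ∈ primeDivisors t → p ≢ r
    fresh r∈ refl = p∤t (proj₂ (elim {t} r∈))
    -- A prime r other than p is not divisible by p, so `u⊥` makes `u` coprime to r; if r also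
    -- divides `u`, it would be 1.
    only-p : ∀ {r} → Prime r → r ∣ val u → r ≡ p
    only-p {r} pr r∣u with r ℕ.≟ p
    ... | yes r≡p = r≡p
    ... | no  r≢p = ⊥-elim (¬prime[1] (subst Prime (u⊥ p∤r (r∣u , ∣.∣-refl)) pr))
      where
      p∤r : p ∤ r
      p∤r p∣r with prime⇒irreducible pr p∣r
      ... | inj₁ refl = ¬prime[1] prime
      ... | inj₂ p≡r  = r≢p (sym p≡r)
    l⊆r : primeDivisors (u *⁺ t) ⊆ p ∷ primeDivisors t
    l⊆r {r} r∈ with pr , r∣ut ← elim {u *⁺ t} r∈ with euclidsLemma (val u) (val t) pr r∣ut
    ... | inj₁ r∣u = here (only-p pr r∣u)
    ... | inj₂ r∣t = there (intro {t} pr r∣t)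
    r⊆l : p ∷ primeDivisors t ⊆ primeDivisors (u *⁺ t)
    r⊆l (here refl) = intro {u *⁺ t} prime (∣m⇒∣m*n (val t) p∣u)
    r⊆l (there r∈)  = let pr , r∣t = elim {t} r∈ in intro {u *⁺ t} pr (∣n⇒∣m*n (val u) r∣t)

  -- Since p does not divide `d`, the divisor `d` of u m′ is coprime to `u` and hence divides m′;
  -- all of `u` then goes to the codivisor.
  cancel-u : ∀ {d s} → Split d s m → p ∤ val d → ∃ λ e → Split d e m′ × u *⁺ e ≡ s
  cancel-u {d} {s} (split ds≡m d⊥s) p∤d with coprime-divisor (Coprime.sym (u⊥ p∤d)) (subst (val d ∣_) (cong val (trans ds≡m (sym u*m′))) (m∣m*n (val s)))
  ... | divides zero ()
  ... | divides (suc q) eq = e , split de≡m′ (coprime-∣ ∣.∣-refl (subst (val e ∣_) (cong val ue≡s) (n∣m*n (val u))) d⊥s) , ue≡s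
    where
    e = 1+ q
    de≡m′ : d *⁺ e ≡ m′
    de≡m′ = val-injective (trans (ℕ.*-comm (val d) (suc q)) (sym eq))
    ue≡s : u *⁺ e ≡ s
    ue≡s = *⁺-cancelˡ d (trans (*⁺-swapˡ d u e) (trans (cong (u *⁺_) de≡m′) (trans u*m′ (sym ds≡m))))

  adjoin-u : ∀ {d e} → Split d e m′ → Split d (u *⁺ e) m
  adjoin-u {d} {e} s@(split de≡m′ d⊥e) = split
    (trans (*⁺-swapˡ d u e) (trans (cong (u *⁺_) de≡m′) u*m′))
    (coprime-*ʳ {val d} {val u} {val e} (Coprime.sym (u⊥ (p∤ (ud⁺ s)))) d⊥e)

  -- A unitary divisor contains either none of the prime power `u` or all of it, because p cannot
  -- divide both it and its codivisor.
  ud-step : unitaryDivisors m ↭ unitaryDivisors m′ ++ map (u *⁺_) (unitaryDivisors m′)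
  ud-step = unique∧set⇒↭ (ud-unique m)
    (Unique.++⁺ (ud-unique m′) (Unique.map⁺ (*⁺-cancelˡ u) (ud-unique m′)) disjoint) l⊆r r⊆l
    where
    V = unitaryDivisors m′
    disjoint : ∀ {d} → d ∈ V × d ∈ map (u *⁺_) V → ⊥
    disjoint (d∈ , ud∈) with e , _ , refl ← ∈.∈-map⁻ (u *⁺_) ud∈ = p∤ d∈ (∣m⇒∣m*n (val e) p∣u)
    l⊆r : unitaryDivisors m ⊆ V ++ map (u *⁺_) V
    l⊆r {d} d∈ with s ← ud⁻ m d∈ with p ∣? val d
    ... | no  p∤d = ∈.∈-++⁺ˡ (ud⁺ (proj₁ (proj₂ (cancel-u s p∤d))))
    ... | yes p∣d =
      -- Here `cancel-u` is applied to the codivisor, which p misses by coprimality.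
      let p∤s = λ p∣s → ¬prime[1] (subst Prime (coprime s (p∣d , p∣s)) prime)
          e , s′ , ue≡d = cancel-u (Split-sym s) p∤s
      in ∈.∈-++⁺ʳ V (subst (_∈ map (u *⁺_) V) ue≡d (∈.∈-map⁺ (u *⁺_) (ud⁺ (Split-sym s′))))
    r⊆l : V ++ map (u *⁺_) V ⊆ unitaryDivisors m
    r⊆l d∈ with ∈.∈-++⁻ V d∈
    ... | inj₁ d∈V = ud⁺ (adjoin-u (ud⁻ m′ d∈V))
    ... | inj₂ d∈u with d , d∈V , refl ← ∈.∈-map⁻ (u *⁺_) d∈u = ud⁺ (Split-sym (adjoin-u (Split-sym (ud⁻ m′ d∈V))))

-- The two halves given by `ud-step` cancel: adjoining `u` adds one prime and so changes the sign of
-- `μ*`.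
∑μ*≡0 : ∀ {m} → m ≢ 1⁺ → ∑ℚ (unitaryDivisors m) (⌜_⌝ ∘ μ*) ≡ 0ℚ
∑μ*≡0 {m} m≢1 = begin
  ∑ℚ (unitaryDivisors m) (⌜_⌝ ∘ μ*)                 ≡⟨ ∑ℚ-↭ (ud-step part) ⟩
  ∑ℚ (V ++ map (u *⁺_) V) (⌜_⌝ ∘ μ*)                ≡⟨ ∑ℚ-++ V ⟩
  s + ∑ℚ (map (u *⁺_) V) (⌜_⌝ ∘ μ*)                 ≡⟨ cong (s +_) (∑ℚ-map V) ⟩
  s + ∑ℚ V (λ t → ⌜ μ* (u *⁺ t) ⌝)                  ≡⟨ cong (s +_) (∑ℚ-cong V flip) ⟩
  s + ∑ℚ V (λ t → - ⌜ μ* t ⌝)                       ≡⟨ cong (s +_) (∑ℚ-neg V) ⟩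
  s - s                                             ≡⟨ ℚ.+-inverseʳ s ⟩
  0ℚ                                                ∎
  where
  open ≡.≡-Reasoning
  part = primePart m≢1
  open PrimePart part
  V = unitaryDivisors m′
  s = ∑ℚ V (⌜_⌝ ∘ μ*)
  flip : ∀ {t} → t ∈ V → ⌜ μ* (u *⁺ t) ⌝ ≡ - ⌜ μ* t ⌝
  flip {t} t∈ = trans (cong ⌜_⌝ (trans (cong (ℤ.-1ℤ ℤ.^_) (ω-step part (p∤ part t∈))) (ℤ.-1*i≡-i (μ* t)))) (⌜⌝-neg (μ* t))

-- Each prime doubles the list by `ud-step`. The induction is on ω(m), since m′ is not structurally
-- smaller than m.
length-ud : ∀ m → length (unitaryDivisors m) ≡ 2 ℕ.^ ω m
length-ud m = go (ω m) m refl
  where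
  one? : ∀ m → Dec (m ≡ 1⁺)
  one? (1+ zero)  = yes refl
  one? (1+ suc _) = no λ ()
  step : ∀ {m} (part : PrimePart m) → ω m ≡ suc (ω (PrimePart.m′ part))
  step part = trans (cong ω (sym (PrimePart.u*m′ part))) (ω-step part (PrimePart.p∤m′ part))
  go : ∀ k m → ω m ≡ k → length (unitaryDivisors m) ≡ 2 ℕ.^ ω m
  go k m ωm≡k with one? m
  ... | yes refl = refl
  go zero m ωm≡0 | no m≢1 = ⊥-elim (ℕ.0≢1+n (trans (sym ωm≡0) (step (primePart m≢1))))
  go (suc k) m ωm≡k | no m≢1 = begin
    length (unitaryDivisors m)                     ≡⟨ ↭.↭-length (ud-step part) ⟩
    length (V ++ map (u *⁺_) V)                    ≡⟨ List.length-++ V ⟩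
    length V ℕ.+ length (map (u *⁺_) V)            ≡⟨ cong (length V ℕ.+_) (List.length-map (u *⁺_) V) ⟩
    length V ℕ.+ length V                          ≡⟨ cong (length V ℕ.+_) (ℕ.+-identityʳ (length V)) ⟨
    2 ℕ.* length V                                 ≡⟨ cong (2 ℕ.*_) (go k m′ (ℕ.suc-injective (trans (sym (step part)) ωm≡k))) ⟩
    2 ℕ.^ suc (ω m′)                               ≡⟨ cong (2 ℕ.^_) (step part) ⟨
    2 ℕ.^ ω m                                      ∎
    where
    open ≡.≡-Reasoning
    part = primePart m≢1
    open PrimePart part
    V = unitaryDivisors m′

-- After regrouping, the factor of ψ(e) is the sum of `μ*` over the unitary divisors of n/e, which
-- vanishes unless e = n. It serves both the inversion of f and the defining property of `c̃`.
unitary-inversion : ∀ n (ψ : ℕ⁺ → ℚ) →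
  ∑ℚ (unitaryDivisors n) (λ d → ∑ℚ (unitaryDivisors d) λ e → ψ e * ⌜ μ* (d ÷ e) ⌝) ≡ ψ n
unitary-inversion n ψ = begin
  _                                                                                  ≡⟨ ∑-regroup n (λ e t → ψ e * ⌜ μ* t ⌝) ⟩
  ∑ℚ (unitaryDivisors n) (λ e → ∑ℚ (unitaryDivisors (n ÷ e)) λ t → ψ e * ⌜ μ* t ⌝)   ≡⟨ ∑ℚ-cong (unitaryDivisors n) (λ {e} _ → ∑ℚ-*ˡ (ψ e) (unitaryDivisors (n ÷ e))) ⟩
  ∑ℚ (unitaryDivisors n) (λ e → ψ e * ∑ℚ (unitaryDivisors (n ÷ e)) (⌜_⌝ ∘ μ*))       ≡⟨ ∑ℚ-single (ud-unique n) (ud⁺ n·1) other ⟩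
  -- Once n ÷ n is rewritten to 1, the remaining sum evaluates to 1 by computation.
  ψ n * ∑ℚ (unitaryDivisors (n ÷ n)) (⌜_⌝ ∘ μ*)                                      ≡⟨ cong (λ r → ψ n * ∑ℚ (unitaryDivisors r) (⌜_⌝ ∘ μ*)) (Split-÷ n·1) ⟩
  ψ n * 1ℚ                                                                           ≡⟨ ℚ.*-identityʳ (ψ n) ⟩
  ψ n                                                                                ∎
  where
  open ≡.≡-Reasoning
  n·1 : Split n 1⁺ n
  n·1 = split (val-injective (ℕ.*-identityʳ (val n))) (Coprime.sym (1-coprimeTo (val n)))
  other : ∀ {e} → e ∈ unitaryDivisors n → e ≢ n → ψ e * ∑ℚ (unitaryDivisors (n ÷ e)) (⌜_⌝ ∘ μ*) ≡ 0ℚ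
  other {e} e∈ e≢n = trans (cong (ψ e *_) (∑μ*≡0 n÷e≢1)) (ℚ.*-zeroʳ (ψ e))
    where
    n÷e≢1 : n ÷ e ≢ 1⁺
    n÷e≢1 eq = e≢n (trans (sym (val-injective {e *⁺ 1⁺} {e} (ℕ.*-identityʳ (val e)))) (trans (cong (e *⁺_) (sym eq)) (product (ud⁻ n e∈))))

-- Vectors

∑-choices : (xs : List A) (xss : Vec (List A) k) {F : Vec A (suc k) → ℚ} →
  ∑ℚ (choices (xs ∷ xss)) F ≡ ∑ℚ xs λ x → ∑ℚ (choices xss) λ v → F (x ∷ v)
∑-choices []       xss = refl
∑-choices (x ∷ xs) xss = trans (∑ℚ-++ (map (x ∷_) (choices xss))) (cong₂ _+_ (∑ℚ-map (choices xss)) (∑-choices xs xss))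

length-choices : (xs : List A) (xss : Vec (List A) k) → length (choices (xs ∷ xss)) ≡ length xs ℕ.* length (choices xss)
length-choices []       xss = refl
length-choices (x ∷ xs) xss = trans (List.length-++ (map (x ∷_) (choices xss)))
  (cong₂ ℕ._+_ (List.length-map (x ∷_) (choices xss)) (length-choices xs xss))

choices⁺ : {v : Vec A k} {xss : Vec (List A) k} → Pointwise _∈_ v xss → v ∈ choices xss
choices⁺ []       = here refl
choices⁺ (p ∷ ps) = ∈.∈-cartesianProductWith⁺ _∷_ p (choices⁺ ps)

choices⁻ : (xss : Vec (List A) k) {v : Vec A k} → v ∈ choices xss → Pointwise _∈_ v xss
choices⁻ []         (here refl) = []
choices⁻ (xs ∷ xss) v∈ with _ , _ , p , q , refl ← ∈.∈-cartesianProductWith⁻ _∷_ xs (choices xss) v∈ = p ∷ choices⁻ xss q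

choices-unique : {xss : Vec (List A) k} → All Unique xss → Unique (choices xss)
choices-unique []       = ListAll.[] ∷ []
choices-unique (u ∷ us) = Unique.cartesianProductWith⁺ _∷_ ∷-injective u (choices-unique us)

unitaryDivisorsₖ : Vec ℕ⁺ k → List (Vec ℕ⁺ k)
unitaryDivisorsₖ n = choices (Vec.map unitaryDivisors n)

length-udₖ : (n : Vec ℕ⁺ k) → length (unitaryDivisorsₖ n) ≡ 2 ℕ.^ Vec.sum (Vec.map ω n)
length-udₖ []       = refl
length-udₖ (n ∷ ns) = trans (length-choices (unitaryDivisors n) (Vec.map unitaryDivisors ns))
  (trans (cong₂ ℕ._*_ (length-ud n) (length-udₖ ns)) (sym (ℕ.^-distribˡ-+-* 2 (ω n) (Vec.sum (Vec.map ω ns)))))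

Coprimeₖ : (m q : Vec ℕ⁺ k) → Set
Coprimeₖ = Pointwise λ a b → gcd (val a) (val b) ≡ 1

-- With `udₖ⁻` this is the bijection between coprime pairs (m , q) and vectors d = m q with a chosen
-- unitary divisor q, coordinate by coordinate.
udₖ⁺ : {m q : Vec ℕ⁺ k} → Coprimeₖ m q →
  q ∈ unitaryDivisorsₖ (zipWith _*⁺_ m q) × zipWith _÷_ (zipWith _*⁺_ m q) q ≡ m
udₖ⁺ []                             = here refl , refl
udₖ⁺ {m = m ∷ ms} {q = q ∷ qs} (g ∷ gs) =
  let q∈ , eq = udₖ⁺ gs
      s = Split-sym (split refl (gcd≡1⇒coprime g))
  in ∈.∈-cartesianProductWith⁺ _∷_ (ud⁺ s) q∈ , cong₂ _∷_ (Split-÷ s) eq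

udₖ⁻ : (d : Vec ℕ⁺ k) {q : Vec ℕ⁺ k} → q ∈ unitaryDivisorsₖ d →
  Coprimeₖ (zipWith _÷_ d q) q × zipWith _*⁺_ (zipWith _÷_ d q) q ≡ d
udₖ⁻ []       (here refl) = [] , refl
udₖ⁻ (d ∷ ds) q∈ with _ , _ , p , ps , refl ← ∈.∈-cartesianProductWith⁻ _∷_ (unitaryDivisors d) (unitaryDivisorsₖ ds) q∈ =
  let s = Split-sym (ud⁻ d p)
      gs , eq = udₖ⁻ ds ps
  in coprime⇒gcd≡1 (coprime s) ∷ gs , cong₂ _∷_ (product s) eq

udₖ-unique : (n : Vec ℕ⁺ k) → Unique (unitaryDivisorsₖ n)
udₖ-unique n = choices-unique (lists n)
  where
  lists : ∀ {k} (n : Vec ℕ⁺ k) → All Unique (Vec.map unitaryDivisors n)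
  lists []       = []
  lists (n ∷ ns) = ud-unique n ∷ lists ns

-- Rectangles and boxes

_≼_ : Vec ℕ⁺ k → Vec ℕ k → Set
_≼_ = Pointwise λ d n → val d ℕ.≤ n

rectangle⁺ : {v : Vec ℕ⁺ k} {N : Vec ℕ k} → v ≼ N → v ∈ rectangle N
rectangle⁺ []       = here refl
rectangle⁺ (p ∷ ps) = ∈.∈-cartesianProductWith⁺ _∷_ ([1⋯]⁺ p) (rectangle⁺ ps)

rectangle⁻ : (N : Vec ℕ k) {v : Vec ℕ⁺ k} → v ∈ rectangle N → v ≼ N
rectangle⁻ []       (here refl) = []
rectangle⁻ (n ∷ N) v∈ with _ , _ , p , ps , refl ← ∈.∈-cartesianProductWith⁻ _∷_ [1⋯ n ] (rectangle N) v∈ = [1⋯]⁻ p ∷ rectangle⁻ N ps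

rectangle-unique : (N : Vec ℕ k) → Unique (rectangle N)
rectangle-unique N = choices-unique (lists N)
  where
  lists : ∀ {k} (N : Vec ℕ k) → All Unique (Vec.map [1⋯_] N)
  lists []      = []
  lists (n ∷ N) = [1⋯]-unique n ∷ lists N

-- Cubes exhaust all vectors and depend on a single number, which makes them the scale for tails
-- although limits run over rectangles with independent sides.
box : ℕ → List (Vec ℕ⁺ k)
box M = rectangle (Vec.replicate _ M)

All-≤-replicate : ∀ {M N} → M ℕ.≤ N → All (M ℕ.≤_) (Vec.replicate k N)
All-≤-replicate {zero}  _   = []
All-≤-replicate {suc k} M≤N = M≤N ∷ All-≤-replicate M≤N

All-≤-trans : ∀ {L M} {N : Vec ℕ k} → L ℕ.≤ M → All (M ℕ.≤_) N → All (L ℕ.≤_) N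
All-≤-trans L≤M []       = []
All-≤-trans L≤M (p ∷ ps) = ℕ.≤-trans L≤M p ∷ All-≤-trans L≤M ps

box⊆ : ∀ {M} {N : Vec ℕ k} → All (M ℕ.≤_) N → box M ⊆ rectangle N
box⊆ {M = M} M≤N v∈ = rectangle⁺ (go (rectangle⁻ (Vec.replicate _ M) v∈) M≤N)
  where
  go : ∀ {k} {v : Vec ℕ⁺ k} {N} → v ≼ Vec.replicate k M → All (M ℕ.≤_) N → v ≼ N
  go []       []       = []
  go (p ∷ ps) (q ∷ qs) = ℕ.≤-trans p q ∷ go ps qs

-- A crude common bound for the coordinates, used only to place a given vector in some box.
size : Vec ℕ⁺ k → ℕ
size = Vec.foldr′ (λ x s → val x ℕ.+ s) 0

size≤⇒box : {v : Vec ℕ⁺ k} → ∀ {B} → size v ℕ.≤ B → v ∈ box B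
size≤⇒box s≤B = rectangle⁺ (go _ s≤B)
  where
  go : ∀ {k} (v : Vec ℕ⁺ k) {B} → size v ℕ.≤ B → v ≼ Vec.replicate k B
  go []      _   = []
  go (x ∷ v) s≤B = ℕ.m+n≤o⇒m≤o (val x) s≤B ∷ go v (ℕ.m+n≤o⇒n≤o (val x) s≤B)

-- All entries are at least 1. Used contrapositively: once either factor leaves a box, so does the
-- product.
≼-*⁺ : (m q : Vec ℕ⁺ k) {N : Vec ℕ k} → zipWith _*⁺_ m q ≼ N → m ≼ N × q ≼ N
≼-*⁺ []       []       []       = [] , []
≼-*⁺ (m ∷ ms) (q ∷ qs) (p ∷ ps) =
  let l , r = ≼-*⁺ ms qs ps
  in ℕ.≤-trans (ℕ.m≤m*n (val m) (val q)) p ∷ l , ℕ.≤-trans (ℕ.m≤n*m (val q) (val m)) p ∷ r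

-- Inversion, orthogonality and a bound for the Ramanujan sums

μₖ : Vec ℕ⁺ k → ℚ
μₖ e = ⌜ ∏ℤ (Vec.map μ* e) ⌝

-- The convolution evaluates `μ*` at the divisor and φ at the quotient; reflecting the inner sum
-- exchanges these roles, and `unitary-inversion` applies.
möbius-inversion : ∀ n (φ : ℕ⁺ → ℚ) →
  ∑ℚ (unitaryDivisors n) (λ d → ∑ℚ (unitaryDivisors d) λ e → ⌜ μ* e ⌝ * φ (d ÷ e)) ≡ φ n
möbius-inversion n φ = trans (∑ℚ-cong (unitaryDivisors n) λ {d} _ →
    trans (∑-reflect d (λ a b → ⌜ μ* a ⌝ * φ b)) (∑ℚ-cong (unitaryDivisors d) λ {e} _ → ℚ.*-comm ⌜ μ* (d ÷ e) ⌝ (φ e)))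
  (unitary-inversion n φ)

-- Induction on the number of variables: with the first pair (d , e) held fixed, the induction
-- hypothesis collapses the other coordinates and leaves the one-variable inversion.
möbius-inversionₖ : (n : Vec ℕ⁺ k) (φ : Vec ℕ⁺ k → ℚ) →
  ∑ℚ (unitaryDivisorsₖ n) (λ d → ∑ℚ (unitaryDivisorsₖ d) λ e → μₖ e * φ (zipWith _÷_ d e)) ≡ φ n
möbius-inversionₖ []       φ = trans (ℚ.+-identityʳ _) (trans (ℚ.+-identityʳ _) (ℚ.*-identityˡ (φ [])))
möbius-inversionₖ (n ∷ ns) φ = begin
  _
    ≡⟨ ∑-choices (unitaryDivisors n) (Vec.map unitaryDivisors ns) ⟩
  ∑ℚ (unitaryDivisors n) (λ d → ∑ℚ (unitaryDivisorsₖ ns) λ v → ∑ℚ (unitaryDivisorsₖ (d ∷ v)) λ e → μₖ e * φ (zipWith _÷_ (d ∷ v) e))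
    ≡⟨ ∑ℚ-cong (unitaryDivisors n) (λ {d} _ → trans (∑ℚ-cong (unitaryDivisorsₖ ns) λ {v} _ → ∑-choices (unitaryDivisors d) (Vec.map unitaryDivisors v)) (∑ℚ-swap (unitaryDivisorsₖ ns) (unitaryDivisors d))) ⟩
  ∑ℚ (unitaryDivisors n) (λ d → ∑ℚ (unitaryDivisors d) λ e → ∑ℚ (unitaryDivisorsₖ ns) λ v → ∑ℚ (unitaryDivisorsₖ v) λ w → μₖ (e ∷ w) * φ (d ÷ e ∷ zipWith _÷_ v w))
    ≡⟨ ∑ℚ-cong (unitaryDivisors n) (λ {d} _ → ∑ℚ-cong (unitaryDivisors d) λ {e} _ → factor d e) ⟩
  ∑ℚ (unitaryDivisors n) (λ d → ∑ℚ (unitaryDivisors d) λ e → ⌜ μ* e ⌝ * φ (d ÷ e ∷ ns))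
    ≡⟨ möbius-inversion n (λ t → φ (t ∷ ns)) ⟩
  φ (n ∷ ns) ∎
  where
  open ≡.≡-Reasoning
  factor : ∀ d e → ∑ℚ (unitaryDivisorsₖ ns) (λ v → ∑ℚ (unitaryDivisorsₖ v) λ w → μₖ (e ∷ w) * φ (d ÷ e ∷ zipWith _÷_ v w)) ≡ ⌜ μ* e ⌝ * φ (d ÷ e ∷ ns)
  factor d e = begin
    _
      ≡⟨ ∑ℚ-cong (unitaryDivisorsₖ ns) (λ {v} _ → trans (∑ℚ-cong (unitaryDivisorsₖ v) λ {w} _ → term v w) (∑ℚ-*ˡ ⌜ μ* e ⌝ (unitaryDivisorsₖ v))) ⟩
    ∑ℚ (unitaryDivisorsₖ ns) (λ v → ⌜ μ* e ⌝ * ∑ℚ (unitaryDivisorsₖ v) λ w → μₖ w * φ (d ÷ e ∷ zipWith _÷_ v w))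
      ≡⟨ ∑ℚ-*ˡ ⌜ μ* e ⌝ (unitaryDivisorsₖ ns) ⟩
    ⌜ μ* e ⌝ * ∑ℚ (unitaryDivisorsₖ ns) (λ v → ∑ℚ (unitaryDivisorsₖ v) λ w → μₖ w * φ (d ÷ e ∷ zipWith _÷_ v w))
      ≡⟨ cong (⌜ μ* e ⌝ *_) (möbius-inversionₖ ns (λ t → φ (d ÷ e ∷ t))) ⟩
    ⌜ μ* e ⌝ * φ (d ÷ e ∷ ns) ∎
    where
    term : ∀ v w → μₖ (e ∷ w) * φ (d ÷ e ∷ zipWith _÷_ v w) ≡ ⌜ μ* e ⌝ * (μₖ w * φ (d ÷ e ∷ zipWith _÷_ v w))
    term v w = trans (cong (_* x) (⌜⌝-* (μ* e) (∏ℤ (Vec.map μ* w)))) (ℚ.*-assoc ⌜ μ* e ⌝ (μₖ w) x)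
      where x = φ (d ÷ e ∷ zipWith _÷_ v w)

-- The explicit formula exhibits `c̃` as the convolution with `μ*` of the function ψ(e) = e or 0
-- according to e ∥ n; inversion recovers ψ. This is the characterising identity of the sums.
c̃-sum : ∀ d n → ∑ℚ (unitaryDivisors d) (λ q → ⌜ c̃ q n ⌝) ≡ (if does (d ∥? n) then ⌜ ℤ.+ val d ⌝ else 0ℚ)
c̃-sum d n = trans (∑ℚ-cong (unitaryDivisors d) λ {q} _ → expand q) (unitary-inversion d ψ)
  where
  ψ : ℕ⁺ → ℚ
  ψ e = if does (e ∥? n) then ⌜ ℤ.+ val e ⌝ else 0ℚ
  term : ∀ q e → (if does (e ∥? n) then ⌜ ℤ.+ val e ℤ.* μ* (q ÷ e) ⌝ else 0ℚ) ≡ ψ e * ⌜ μ* (q ÷ e) ⌝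
  term q e with does (e ∥? n)
  ... | true  = ⌜⌝-* (ℤ.+ val e) (μ* (q ÷ e))
  ... | false = sym (ℚ.*-zeroˡ ⌜ μ* (q ÷ e) ⌝)
  expand : ∀ q → ⌜ c̃ q n ⌝ ≡ ∑ℚ (unitaryDivisors q) λ e → ψ e * ⌜ μ* (q ÷ e) ⌝
  expand q = trans (⌜⌝-∑ℤ (filter (_∥? n) (unitaryDivisors q)) {λ e → ℤ.+ val e ℤ.* μ* (q ÷ e)})
    (trans (∑ℚ-filter (_∥? n) (unitaryDivisors q)) (∑ℚ-cong (unitaryDivisors q) λ {e} _ → term q e))

-- By `c̃-sum` the inner sum is φ(d) when d ∥ n, with d cancelling its reciprocal, and 0 otherwise.
-- All surviving d are at most n, so the value does not depend on N.
c̃-orthogonality : ∀ n N → val n ℕ.≤ N → (φ : ℕ⁺ → ℚ) →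
  ∑ℚ [1⋯ N ] (λ d → ∑ℚ (unitaryDivisors d) λ q → (recip d * ⌜ c̃ q n ⌝) * φ d) ≡ ∑ℚ (unitaryDivisors n) φ
c̃-orthogonality n N n≤N φ = begin
  _                                                                 ≡⟨ ∑ℚ-cong [1⋯ N ] (λ {d} _ → inner d) ⟩
  ∑ℚ [1⋯ N ] (λ d → if does (d ∥? n) then φ d else 0ℚ)              ≡⟨ ∑ℚ-filter (_∥? n) [1⋯ N ] ⟨
  ∑ℚ (filter (_∥? n) [1⋯ N ]) φ                                     ≡⟨ ∑ℚ-↭ (unique∧set⇒↭ (Unique.filter⁺ (_∥? n) ([1⋯]-unique N)) (ud-unique n) l⊆r r⊆l) ⟩
  ∑ℚ (unitaryDivisors n) φ                                          ∎
  where
  open ≡.≡-Reasoning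
  inner : ∀ d → ∑ℚ (unitaryDivisors d) (λ q → (recip d * ⌜ c̃ q n ⌝) * φ d) ≡ (if does (d ∥? n) then φ d else 0ℚ)
  inner d = begin
    _                                                               ≡⟨ ∑ℚ-cong (unitaryDivisors d) (λ {q} _ → solve 3 (λ r c f → (r :* c) :* f := (f :* r) :* c) refl (recip d) ⌜ c̃ q n ⌝ (φ d)) ⟩
    ∑ℚ (unitaryDivisors d) (λ q → (φ d * recip d) * ⌜ c̃ q n ⌝)      ≡⟨ ∑ℚ-*ˡ (φ d * recip d) (unitaryDivisors d) ⟩
    φ d * recip d * ∑ℚ (unitaryDivisors d) (λ q → ⌜ c̃ q n ⌝)        ≡⟨ cong (φ d * recip d *_) (c̃-sum d n) ⟩
    φ d * recip d * (if does (d ∥? n) then ⌜ ℤ.+ val d ⌝ else 0ℚ)   ≡⟨ select (does (d ∥? n)) ⟩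
    (if does (d ∥? n) then φ d else 0ℚ)                             ∎
    where
    open +-*-Solver
    select : ∀ b → φ d * recip d * (if b then ⌜ ℤ.+ val d ⌝ else 0ℚ) ≡ (if b then φ d else 0ℚ)
    select true  = trans (solve 3 (λ f r v → f :* r :* v := f :* (v :* r)) refl (φ d) (recip d) ⌜ ℤ.+ val d ⌝)
      (trans (cong (φ d *_) (recip-inverse d)) (ℚ.*-identityʳ (φ d)))
    select false = ℚ.*-zeroʳ (φ d * recip d)
  l⊆r : filter (_∥? n) [1⋯ N ] ⊆ unitaryDivisors n
  l⊆r {d} d∈ = ud⁺ (∥⇒Split d (proj₂ (∈.∈-filter⁻ (_∥? n) {xs = [1⋯ N ]} d∈)))
  r⊆l : unitaryDivisors n ⊆ filter (_∥? n) [1⋯ N ]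
  r⊆l {d} d∈ with d∈n , d∥n ← ∈.∈-filter⁻ (_∥? n) {xs = [1⋯ val n ]} d∈ = ∈.∈-filter⁺ (_∥? n) ([1⋯]⁺ (ℕ.≤-trans ([1⋯]⁻ d∈n) n≤N)) d∥n

c̃ₖ : Vec ℕ⁺ k → Vec ℕ⁺ k → ℚ
c̃ₖ q n = ⌜ ∏ℤ (zipWith c̃ q n) ⌝

c̃ₖ-orthogonality : (n : Vec ℕ⁺ k) {N : Vec ℕ k} → n ≼ N → (φ : Vec ℕ⁺ k → ℚ) →
  ∑ℚ (rectangle N) (λ d → ∑ℚ (unitaryDivisorsₖ d) λ q → (recip (∏⁺ d) * c̃ₖ q n) * φ d) ≡ ∑ℚ (unitaryDivisorsₖ n) φ
c̃ₖ-orthogonality []       []         φ = trans (ℚ.+-identityʳ _) (cong (_+ 0ℚ) (ℚ.*-identityˡ (φ [])))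
c̃ₖ-orthogonality (n ∷ ns) {N ∷ Ns} (p ∷ ps) φ = begin
  _
    ≡⟨ ∑-choices [1⋯ N ] (Vec.map [1⋯_] Ns) ⟩
  ∑ℚ [1⋯ N ] (λ d → ∑ℚ (rectangle Ns) λ v → ∑ℚ (unitaryDivisorsₖ (d ∷ v)) λ q → (recip (∏⁺ (d ∷ v)) * c̃ₖ q (n ∷ ns)) * φ (d ∷ v))
    ≡⟨ ∑ℚ-cong [1⋯ N ] (λ {d} _ → trans (∑ℚ-cong (rectangle Ns) λ {v} _ → ∑-choices (unitaryDivisors d) (Vec.map unitaryDivisors v)) (∑ℚ-swap (rectangle Ns) (unitaryDivisors d))) ⟩
  ∑ℚ [1⋯ N ] (λ d → ∑ℚ (unitaryDivisors d) λ q → ∑ℚ (rectangle Ns) λ v → ∑ℚ (unitaryDivisorsₖ v) λ w → (recip (∏⁺ (d ∷ v)) * c̃ₖ (q ∷ w) (n ∷ ns)) * φ (d ∷ v))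
    ≡⟨ ∑ℚ-cong [1⋯ N ] (λ {d} _ → ∑ℚ-cong (unitaryDivisors d) λ {q} _ → factor d q) ⟩
  ∑ℚ [1⋯ N ] (λ d → ∑ℚ (unitaryDivisors d) λ q → (recip d * ⌜ c̃ q n ⌝) * ∑ℚ (unitaryDivisorsₖ ns) (λ v → φ (d ∷ v)))
    ≡⟨ c̃-orthogonality n N p (λ d → ∑ℚ (unitaryDivisorsₖ ns) (λ v → φ (d ∷ v))) ⟩
  ∑ℚ (unitaryDivisors n) (λ d → ∑ℚ (unitaryDivisorsₖ ns) (λ v → φ (d ∷ v)))
    ≡⟨ ∑-choices (unitaryDivisors n) (Vec.map unitaryDivisors ns) ⟨
  ∑ℚ (unitaryDivisorsₖ (n ∷ ns)) φ ∎
  where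
  open ≡.≡-Reasoning
  factor : ∀ d q → ∑ℚ (rectangle Ns) (λ v → ∑ℚ (unitaryDivisorsₖ v) λ w → (recip (∏⁺ (d ∷ v)) * c̃ₖ (q ∷ w) (n ∷ ns)) * φ (d ∷ v)) ≡ (recip d * ⌜ c̃ q n ⌝) * ∑ℚ (unitaryDivisorsₖ ns) (λ v → φ (d ∷ v))
  factor d q = begin
    _
      ≡⟨ ∑ℚ-cong (rectangle Ns) (λ {v} _ → trans (∑ℚ-cong (unitaryDivisorsₖ v) λ {w} _ → term v w) (∑ℚ-*ˡ (recip d * ⌜ c̃ q n ⌝) (unitaryDivisorsₖ v))) ⟩
    ∑ℚ (rectangle Ns) (λ v → (recip d * ⌜ c̃ q n ⌝) * ∑ℚ (unitaryDivisorsₖ v) λ w → (recip (∏⁺ v) * c̃ₖ w ns) * φ (d ∷ v))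
      ≡⟨ ∑ℚ-*ˡ (recip d * ⌜ c̃ q n ⌝) (rectangle Ns) ⟩
    (recip d * ⌜ c̃ q n ⌝) * ∑ℚ (rectangle Ns) (λ v → ∑ℚ (unitaryDivisorsₖ v) λ w → (recip (∏⁺ v) * c̃ₖ w ns) * φ (d ∷ v))
      ≡⟨ cong ((recip d * ⌜ c̃ q n ⌝) *_) (c̃ₖ-orthogonality ns ps (λ v → φ (d ∷ v))) ⟩
    (recip d * ⌜ c̃ q n ⌝) * ∑ℚ (unitaryDivisorsₖ ns) (λ v → φ (d ∷ v)) ∎
    where
    open +-*-Solver
    term : ∀ v w → (recip (∏⁺ (d ∷ v)) * c̃ₖ (q ∷ w) (n ∷ ns)) * φ (d ∷ v) ≡ (recip d * ⌜ c̃ q n ⌝) * ((recip (∏⁺ v) * c̃ₖ w ns) * φ (d ∷ v))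
    term v w = trans (cong₂ (λ a b → (a * b) * φ (d ∷ v)) (recip-* d (∏⁺ v)) (⌜⌝-* (c̃ q n) (∏ℤ (zipWith c̃ w ns))))
      (solve 5 (λ a b c d f → (a :* b) :* (c :* d) :* f := (a :* c) :* ((b :* d) :* f)) refl (recip d) (recip (∏⁺ v)) ⌜ c̃ q n ⌝ (c̃ₖ w ns) (φ (d ∷ v)))

∣μ*∣≡1 : ∀ n → ∣ ⌜ μ* n ⌝ ∣ ≡ 1ℚ
∣μ*∣≡1 n = go (ω n)
  where
  go : ∀ j → ∣ ⌜ ℤ.-1ℤ ℤ.^ j ⌝ ∣ ≡ 1ℚ
  go zero    = refl
  go (suc j) = trans (cong ∣_∣ (trans (cong ⌜_⌝ (ℤ.-1*i≡-i (ℤ.-1ℤ ℤ.^ j))) (⌜⌝-neg (ℤ.-1ℤ ℤ.^ j)))) (trans (ℚ.∣-p∣≡∣p∣ ⌜ ℤ.-1ℤ ℤ.^ j ⌝) (go j))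

-- Every d in the formula divides n, so the absolute value is at most 1 + 2 + ... + n, whatever q
-- is.
c̃-bounded : ∀ n → ∃ λ C → 0ℚ < C × ∀ q → ∣ ⌜ c̃ q n ⌝ ∣ ≤ C
-- The extra 1 gives strict positivity at once; later estimates divide by this bound.
c̃-bounded n = 1ℚ + S , ℚ.+-mono-<-≤ 0<1 0≤S , λ q → begin
  ∣ ⌜ c̃ q n ⌝ ∣                                        ≡⟨ cong ∣_∣ (⌜⌝-∑ℤ (L q) {t q}) ⟩
  ∣ ∑ℚ (L q) (⌜_⌝ ∘ t q) ∣                             ≤⟨ ∣∑ℚ∣≤ (L q) ⟩
  ∑ℚ (L q) (λ d → ∣ ⌜ t q d ⌝ ∣)                       ≡⟨ ∑ℚ-cong (L q) (λ {d} _ → abs q d) ⟩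
  ∑ℚ (L q) (λ d → ⌜ ℤ.+ val d ⌝)                       ≤⟨ ∑ℚ-⊆ (Unique.filter⁺ (_∥? n) (ud-unique q)) (sub q) (λ d → 0≤⌜+⌝ (val d)) ⟩
  S                                                    ≡⟨ ℚ.+-identityˡ S ⟨
  0ℚ + S                                               ≤⟨ ℚ.+-monoˡ-≤ S (ℚ.<⇒≤ 0<1) ⟩
  1ℚ + S                                               ∎
  where
  open ℚ.≤-Reasoning
  S = ∑ℚ [1⋯ val n ] (λ d → ⌜ ℤ.+ val d ⌝)
  0≤S : 0ℚ ≤ S
  0≤S = ∑ℚ-nonneg [1⋯ val n ] (λ d → 0≤⌜+⌝ (val d))
  L : ℕ⁺ → List ℕ⁺
  L q = filter (_∥? n) (unitaryDivisors q)
  t : ℕ⁺ → ℕ⁺ → ℤ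
  t q d = ℤ.+ val d ℤ.* μ* (q ÷ d)
  abs : ∀ q d → ∣ ⌜ t q d ⌝ ∣ ≡ ⌜ ℤ.+ val d ⌝
  abs q d = trans (cong ∣_∣ (⌜⌝-* (ℤ.+ val d) (μ* (q ÷ d)))) (trans (ℚ.∣p*q∣≡∣p∣*∣q∣ ⌜ ℤ.+ val d ⌝ ⌜ μ* (q ÷ d) ⌝)
    (trans (cong₂ _*_ (ℚ.0≤p⇒∣p∣≡p (0≤⌜+⌝ (val d))) (∣μ*∣≡1 (q ÷ d))) (ℚ.*-identityʳ ⌜ ℤ.+ val d ⌝)))
  sub : ∀ q → L q ⊆ [1⋯ val n ]
  sub q d∈ = [1⋯]⁺ (∣⇒≤ (proj₁ (proj₂ (∈.∈-filter⁻ (_∥? n) {xs = unitaryDivisors q} d∈))))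

c̃ₖ-bounded : (n : Vec ℕ⁺ k) → ∃ λ C → 0ℚ < C × ∀ q → ∣ c̃ₖ q n ∣ ≤ C
c̃ₖ-bounded []       = 1ℚ , 0<1 , λ { [] → ℚ.≤-refl }
c̃ₖ-bounded (n ∷ ns) =
  let C , 0<C , hC = c̃-bounded n
      D , 0<D , hD = c̃ₖ-bounded ns
  in C * D , *-pos 0<C 0<D , λ { (q ∷ qs) → ℚ.≤-trans
       (ℚ.≤-reflexive (trans (cong ∣_∣ (⌜⌝-* (c̃ q n) (∏ℤ (zipWith c̃ qs ns)))) (ℚ.∣p*q∣≡∣p∣*∣q∣ ⌜ c̃ q n ⌝ (c̃ₖ qs ns))))
       (*-mono-≤ (ℚ.0≤∣p∣ ⌜ c̃ q n ⌝) (ℚ.<⇒≤ 0<D) (hC q) (hD qs)) }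

-- Limits of rational sequences

infix 4 _≲_

-- _≤ℝ_ on the underlying sequences; a record, so that x and y can be inferred.
record _≲_ (x y : ℕ → ℚ) : Set where
  constructor ≲-intro
  field eventually : ∀ ε → 0ℚ < ε → ∃ λ N → ∀ n → N ℕ.≤ n → x n ≤ y n + ε

open _≲_

pointwise : ∀ {x y} → (∀ i → x i ≤ y i) → x ≲ y
pointwise {x} {y} h .eventually ε 0<ε = 0 , λ i _ → ℚ.≤-trans (h i)
  (subst (_≤ y i + ε) (ℚ.+-identityʳ (y i)) (ℚ.+-monoʳ-≤ (y i) (ℚ.<⇒≤ 0<ε)))

≲-trans : ∀ {x y z} → x ≲ y → y ≲ z → x ≲ z
≲-trans {x} {y} {z} x≲y y≲z .eventually ε 0<ε =
  let M , hM = eventually x≲y (ε * ½) (*-pos 0<ε 0<½)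
      N , hN = eventually y≲z (ε * ½) (*-pos 0<ε 0<½)
  in M ℕ.⊔ N , λ i p → begin
    x i                            ≤⟨ hM i (ℕ.m⊔n≤o⇒m≤o M N p) ⟩
    y i + ε * ½                    ≤⟨ ℚ.+-monoˡ-≤ (ε * ½) (hN i (ℕ.m⊔n≤o⇒n≤o M N p)) ⟩
    z i + ε * ½ + ε * ½            ≡⟨ ℚ.+-assoc (z i) (ε * ½) (ε * ½) ⟩
    z i + (ε * ½ + ε * ½)          ≡⟨ cong (z i +_) (half+half ε) ⟩
    z i + ε                        ∎
  where open ℚ.≤-Reasoning

≲-weaken : ∀ {x p q} → p ≤ q → x ≲ (λ _ → p) → x ≲ (λ _ → q)
≲-weaken p≤q x≲p = ≲-trans x≲p (pointwise λ _ → p≤q)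

+-mono-≲ : ∀ {x y u v} → x ≲ y → u ≲ v → (λ i → x i + u i) ≲ (λ i → y i + v i)
+-mono-≲ {x} {y} {u} {v} x≲y u≲v .eventually ε 0<ε =
  let M , hM = eventually x≲y (ε * ½) (*-pos 0<ε 0<½)
      N , hN = eventually u≲v (ε * ½) (*-pos 0<ε 0<½)
  in M ℕ.⊔ N , λ i p → begin
    x i + u i                             ≤⟨ ℚ.+-mono-≤ (hM i (ℕ.m⊔n≤o⇒m≤o M N p)) (hN i (ℕ.m⊔n≤o⇒n≤o M N p)) ⟩
    (y i + ε * ½) + (v i + ε * ½)         ≡⟨ solve 3 (λ y v e → (y :+ e) :+ (v :+ e) := (y :+ v) :+ (e :+ e)) refl (y i) (v i) (ε * ½) ⟩
    (y i + v i) + (ε * ½ + ε * ½)         ≡⟨ cong (y i + v i +_) (half+half ε) ⟩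
    (y i + v i) + ε                       ∎
  where
  open ℚ.≤-Reasoning
  open +-*-Solver

+-mono-≲-halves : ∀ {x u ε} → x ≲ (λ _ → ε * ½) → u ≲ (λ _ → ε * ½) → (λ i → x i + u i) ≲ (λ _ → ε)
+-mono-≲-halves {ε = ε} x≲ u≲ = ≲-weaken (ℚ.≤-reflexive (half+half ε)) (+-mono-≲ x≲ u≲)

*-monoʳ-≲ : ∀ {x y c} → 0ℚ ≤ c → x ≲ y → (λ i → c * x i) ≲ (λ i → c * y i)
*-monoʳ-≲ {x} {y} {c} 0≤c x≲y .eventually ε 0<ε =
  -- The tolerance is divided by c + 1 because `c` may be 0.
  let δ , 0<δ , eq = scale 0<ε (ℚ.+-mono-≤-< 0≤c 0<1)
      M , hM = eventually x≲y δ 0<δ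
  in M , λ i p → begin
    c * x i                        ≤⟨ ℚ.*-monoˡ-≤-nonNeg c {{ℚ.nonNegative 0≤c}} (hM i p) ⟩
    c * (y i + δ)                  ≡⟨ solve 3 (λ c y d → c :* (y :+ d) := c :* y :+ (c :* d :+ con 0ℚ)) refl c (y i) δ ⟩
    c * y i + (c * δ + 0ℚ)         ≤⟨ ℚ.+-monoʳ-≤ (c * y i) (ℚ.+-monoʳ-≤ (c * δ) (ℚ.<⇒≤ 0<δ)) ⟩
    c * y i + (c * δ + δ)          ≡⟨ cong (c * y i +_) (solve 2 (λ c d → c :* d :+ d := (c :+ con 1ℚ) :* d) refl c δ) ⟩
    c * y i + (c + 1ℚ) * δ         ≡⟨ cong (c * y i +_) eq ⟩
    c * y i + ε                    ∎
  where
  open ℚ.≤-Reasoning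
  open +-*-Solver

∑ℚ-mono-≲ : (xs : List A) {F G : A → ℕ → ℚ} → (∀ x → F x ≲ G x) → (λ i → ∑ℚ xs λ x → F x i) ≲ (λ i → ∑ℚ xs λ x → G x i)
∑ℚ-mono-≲ []       _ = pointwise λ _ → ℚ.≤-refl
∑ℚ-mono-≲ (x ∷ xs) h = +-mono-≲ (h x) (∑ℚ-mono-≲ xs h)

-- Lets an auxiliary truncation depend on δ and then disappear from the bound.
≲-limit : ∀ {x ε} → (∀ δ → 0ℚ < δ → x ≲ (λ _ → ε + δ)) → x ≲ (λ _ → ε)
≲-limit {x} {p} h .eventually ε 0<ε =
  let M , hM = eventually (h (ε * ½) (*-pos 0<ε 0<½)) (ε * ½) (*-pos 0<ε 0<½)
  in M , λ i q → ℚ.≤-trans (hM i q) (ℚ.≤-reflexive (trans (ℚ.+-assoc p (ε * ½) (ε * ½)) (cong (p +_) (half+half ε))))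

∣p-r∣≤ : ∀ p q r → ∣ p - r ∣ ≤ ∣ p - q ∣ + ∣ q - r ∣
∣p-r∣≤ p q r = subst (λ t → ∣ t ∣ ≤ ∣ p - q ∣ + ∣ q - r ∣)
  (solve 3 (λ p q r → (p :- q) :+ (q :- r) := p :- r) refl p q r) (ℚ.∣p+q∣≤∣p∣+∣q∣ (p - q) (q - r))
  where open +-*-Solver

0<ι1 : ∀ n → 0ℚ < ι 1 n
0<ι1 n = ℚ.positive⁻¹ (ι 1 n) {{ℚ.normalize-pos 1 (suc n)}}

square-cancel-≤ : ∀ {a b} → 0ℚ ≤ b → a * a ≤ b * b → a ≤ b
square-cancel-≤ {a} {b} 0≤b a²≤b² = ℚ.≮⇒≥ λ b<a → ℚ.<-irrefl refl (begin-strict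
  a * a     ≤⟨ a²≤b² ⟩
  b * b     ≤⟨ ℚ.*-monoˡ-≤-nonNeg b {{ℚ.nonNegative 0≤b}} (ℚ.<⇒≤ b<a) ⟩
  b * a     <⟨ ℚ.*-monoˡ-<-pos a {{ℚ.positive (ℚ.≤-<-trans 0≤b b<a)}} b<a ⟩
  a * a     ∎)
  where open ℚ.≤-Reasoning

∣p∣*∣p∣ : ∀ p → ∣ p ∣ * ∣ p ∣ ≡ p * p
∣p∣*∣p∣ p with ℚ.∣p∣≡p∨∣p∣≡-p p
... | inj₁ e = cong₂ _*_ e e
... | inj₂ e = trans (cong₂ _*_ e e) (solve 1 (λ p → (:- p) :* (:- p) := p :* p) refl p)
  where open +-*-Solver

0≤p*p : ∀ p → 0ℚ ≤ p * p
0≤p*p p = subst (0ℚ ≤_) (∣p∣*∣p∣ p) (*-mono-≤ {0ℚ} {∣ p ∣} {0ℚ} {∣ p ∣} ℚ.≤-refl (ℚ.0≤∣p∣ p) (ℚ.0≤∣p∣ p) (ℚ.0≤∣p∣ p))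

0≤p²+q² : ∀ p q → 0ℚ ≤ p * p + q * q
0≤p²+q² p q = ℚ.+-mono-≤ (0≤p*p p) (0≤p*p q)

-- √ℚ i rounds down by less than ι 1 i, which vanishes in the limit.
∣x∣≲√ : (x p : ℕ → ℚ) → (∀ i → x i * x i ≤ ∣ p i ∣) → (λ i → ∣ x i ∣) ≲ (λ i → √ℚ i (p i))
∣x∣≲√ x p h .eventually ε 0<ε with N , hN ← ι-archimedean ε 0<ε = N , λ i N≤i → ℚ.≤-trans (bound i) (ℚ.+-monoʳ-≤ (√ℚ i (p i)) (hN i N≤i))
  where
  open ℚ.≤-Reasoning
  bound : ∀ i → ∣ x i ∣ ≤ √ℚ i (p i) + ι 1 i
  bound i = subst (∣ x i ∣ ≤_) (ι-suc s i) (square-cancel-≤ (0≤ι (suc s) i) (begin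
    ∣ x i ∣ * ∣ x i ∣                 ≡⟨ ∣p∣*∣p∣ (x i) ⟩
    x i * x i                         ≤⟨ h i ⟩
    ∣ p i ∣                           ≤⟨ ℚ.<⇒≤ (√ℚ-upper i (p i)) ⟩
    ι (suc s) i * ι (suc s) i         ∎))
    where s = √ℚ-num i (p i)

-- Valid at every index, not just eventually, because `√ℚ` rounds down.
√[x²+y²]≤∣x∣+∣y∣ : ∀ i x y → √ℚ i (x * x + y * y) ≤ ∣ x ∣ + ∣ y ∣
√[x²+y²]≤∣x∣+∣y∣ i x y = square-cancel-≤ (ℚ.+-mono-≤ (ℚ.0≤∣p∣ x) (ℚ.0≤∣p∣ y)) (begin
  √ℚ i p * √ℚ i p                                       ≤⟨ √ℚ-lower i p ⟩
  ∣ p ∣                                                 ≡⟨ ℚ.0≤p⇒∣p∣≡p (0≤p²+q² x y) ⟩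
  x * x + y * y                                         ≡⟨ cong₂ _+_ (∣p∣*∣p∣ x) (∣p∣*∣p∣ y) ⟨
  a * a + b * b                                         ≡⟨ ℚ.+-identityʳ _ ⟨
  a * a + b * b + 0ℚ                                    ≤⟨ ℚ.+-monoʳ-≤ (a * a + b * b) (ℚ.+-mono-≤ 0≤ab 0≤ab) ⟩
  a * a + b * b + (a * b + a * b)                       ≡⟨ solve 2 (λ a b → a :* a :+ b :* b :+ (a :* b :+ a :* b) := (a :+ b) :* (a :+ b)) refl a b ⟩
  (a + b) * (a + b)                                     ∎)
  where
  open ℚ.≤-Reasoning
  open +-*-Solver
  p = x * x + y * y
  a = ∣ x ∣
  b = ∣ y ∣
  0≤ab : 0ℚ ≤ a * b
  0≤ab = *-mono-≤ {0ℚ} {a} {0ℚ} {b} ℚ.≤-refl (ℚ.0≤∣p∣ y) (ℚ.0≤∣p∣ x) (ℚ.0≤∣p∣ y)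

-- Multiple series

-- Convergence stated on the underlying sequences, so that terms can be rewritten by rational
-- identities at each index.
Sums : (Vec ℕ⁺ k → ℕ → ℚ) → (ℕ → ℚ) → Set
Sums F s = ∀ ε → 0ℚ < ε → ∃ λ M → ∀ N → All (M ℕ.≤_) N →
  (λ i → ∣ ∑ℚ (rectangle N) (λ v → F v i) - s i ∣) ≲ (λ _ → ε)

seq-∑ℝ : (xs : List A) (F : A → ℝ) → ∀ i → seq (∑ℝ xs F) i ≡ ∑ℚ xs λ x → seq (F x) i
seq-∑ℝ []       F i = refl
seq-∑ℝ (x ∷ xs) F i = cong (seq (F x) i +_) (seq-∑ℝ xs F i)

re-∑ : (xs : List A) (F : A → ℂ) → ∀ i → seq (re (∑ℂ xs F)) i ≡ ∑ℚ xs λ x → seq (re (F x)) i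
re-∑ []       F i = refl
re-∑ (x ∷ xs) F i = cong (seq (re (F x)) i +_) (re-∑ xs F i)

im-∑ : (xs : List A) (F : A → ℂ) → ∀ i → seq (im (∑ℂ xs F)) i ≡ ∑ℚ xs λ x → seq (im (F x)) i
im-∑ []       F i = refl
im-∑ (x ∷ xs) F i = cong (seq (im (F x)) i +_) (im-∑ xs F i)

HasSumℝ⇒Sums : {F : Vec ℕ⁺ k → ℝ} {s : ℝ} → HasSumℝ F s → Sums (λ v → seq (F v)) (seq s)
HasSumℝ⇒Sums {F = F} {s} h ε 0<ε = proj₁ (h ε 0<ε) , λ N M≤N →
  ≲-trans (pointwise {y = λ i → ∣ seq (∑ℝ (rectangle N) F) i - seq s i ∣} λ i → ℚ.≤-reflexive (cong (λ t → ∣ t - seq s i ∣) (sym (seq-∑ℝ (rectangle N) F i))))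
    (≲-intro (proj₂ (h ε 0<ε) N M≤N))

Sums⇒HasSumℝ : {F : Vec ℕ⁺ k → ℝ} {s : ℝ} → Sums (λ v → seq (F v)) (seq s) → HasSumℝ F s
Sums⇒HasSumℝ {F = F} {s} h ε 0<ε = proj₁ (h ε 0<ε) , λ N M≤N → eventually
  (≲-trans (pointwise {λ i → ∣ seq (∑ℝ (rectangle N) F) i - seq s i ∣} λ i → ℚ.≤-reflexive (cong (λ t → ∣ t - seq s i ∣) (seq-∑ℝ (rectangle N) F i))) (proj₂ (h ε 0<ε) N M≤N))

Sums⇒HasSumℂ : {F : Vec ℕ⁺ k → ℂ} {s : ℂ} →
  Sums (λ v → seq (re (F v))) (seq (re s)) → Sums (λ v → seq (im (F v))) (seq (im s)) → HasSumℂ F s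
Sums⇒HasSumℂ {F = F} {s} hre him ε 0<ε = proj₁ hM ℕ.⊔ proj₁ hN , λ K p → eventually
    (≲-trans (pointwise (bound K)) (+-mono-≲-halves {ε = ε}
      (proj₂ hM K (All-≤-trans (ℕ.m≤m⊔n (proj₁ hM) (proj₁ hN)) p))
      (proj₂ hN K (All-≤-trans (ℕ.m≤n⊔m (proj₁ hM) (proj₁ hN)) p))))
  where
  hM = hre (ε * ½) (*-pos 0<ε 0<½)
  hN = him (ε * ½) (*-pos 0<ε 0<½)
  bound : ∀ K i → seq ∣ ∑ℂ (rectangle K) F -ℂ s ∣ℂ i ≤
    ∣ ∑ℚ (rectangle K) (λ v → seq (re (F v)) i) - seq (re s) i ∣ + ∣ ∑ℚ (rectangle K) (λ v → seq (im (F v)) i) - seq (im s) i ∣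
  bound K i = ℚ.≤-trans (√[x²+y²]≤∣x∣+∣y∣ i (seq (re (∑ℂ (rectangle K) F)) i - seq (re s) i) (seq (im (∑ℂ (rectangle K) F)) i - seq (im s) i))
    (ℚ.≤-reflexive (cong₂ (λ a b → ∣ a - seq (re s) i ∣ + ∣ b - seq (im s) i ∣) (re-∑ (rectangle K) F i) (im-∑ (rectangle K) F i)))

∑-cauchy : (xs : List A) {F : A → ℕ → ℚ} → (∀ x → Cauchy (F x)) → Cauchy λ i → ∑ℚ xs λ x → F x i
∑-cauchy []           _ = const-cauchy 0ℚ
∑-cauchy (x ∷ xs) {F} c = +-cauchy {F x} (c x) (∑-cauchy xs {F} c)

-- A diagonal limit: `s j` is the `j`-th approximant read at an index beyond which it varies by at
-- most 1/(j+1).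
complete : (x : ℕ → ℕ → ℚ) → (∀ j → Cauchy (x j)) → (∀ i j → (λ n → ∣ x i n - x j n ∣) ≲ (λ _ → ι 1 i + ι 1 j)) →
  ∃ λ s → ∀ j → (λ n → ∣ x j n - seq s n ∣) ≲ (λ _ → ι 1 j + ι 1 j)
complete x x-cauchy close = mkℝ s s-cauchy , λ j → ≲-intro (converges j)
  where
  open ℚ.≤-Reasoning
  open +-*-Solver
  e : ℕ → ℚ
  e = ι 1
  mod : ∀ j → ∃ λ K → ∀ m n → K ℕ.≤ m → K ℕ.≤ n → ∣ x j m - x j n ∣ ≤ e j
  mod j = x-cauchy j (e j) (0<ι1 j)
  K : ℕ → ℕ
  K j = proj₁ (mod j)
  s : ℕ → ℚ
  s j = x j (K j)
  regroup : ∀ a b → a + ((a + b + b) + b) ≡ (a + a) + (b + (b + b))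
  regroup = solve 2 (λ i j → i :+ ((i :+ j :+ j) :+ j) := (i :+ i) :+ (j :+ (j :+ j))) refl
  -- The comparison goes through a late common index `l`: the two moduli cost e i and e j, and
  -- `close` costs e i + e j with slack e j, making two of the first and three of the second.
  far : ∀ i j n → K i ℕ.≤ n → ∣ x i n - s j ∣ ≤ (e i + e i) + (e j + (e j + e j))
  far i j n Ki≤n =
    let N , hN = eventually (close i j) (e j) (0<ι1 j)
        l = K i ℕ.⊔ K j ℕ.⊔ N
        Ki≤l = ℕ.≤-trans (ℕ.m≤m⊔n (K i) (K j)) (ℕ.m≤m⊔n (K i ℕ.⊔ K j) N)
        Kj≤l = ℕ.≤-trans (ℕ.m≤n⊔m (K i) (K j)) (ℕ.m≤m⊔n (K i ℕ.⊔ K j) N)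
        N≤l = ℕ.m≤n⊔m (K i ℕ.⊔ K j) N
        a = x i n
        b = x i l
        c = x j l
    in begin
    ∣ a - s j ∣                                   ≤⟨ ∣p-r∣≤ a b (s j) ⟩
    ∣ a - b ∣ + ∣ b - s j ∣                       ≤⟨ ℚ.+-monoʳ-≤ ∣ a - b ∣ (∣p-r∣≤ b c (s j)) ⟩
    ∣ a - b ∣ + (∣ b - c ∣ + ∣ c - s j ∣)         ≤⟨ ℚ.+-mono-≤ (proj₂ (mod i) n l Ki≤n Ki≤l) (ℚ.+-mono-≤ (hN l N≤l) (proj₂ (mod j) l (K j) Kj≤l ℕ.≤-refl)) ⟩
    e i + ((e i + e j + e j) + e j)               ≡⟨ regroup (e i) (e j) ⟩
    (e i + e i) + (e j + (e j + e j))             ∎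
  s-cauchy : Cauchy s
  s-cauchy ε 0<ε =
    -- A fifth of ε, for the two plus three errors of `far`.
    let δ , 0<δ , eq = scale 0<ε (0<⌜+suc⌝ 4)
        N , hN = ι-archimedean δ 0<δ
    in N , λ i j p q → begin
    ∣ s i - s j ∣                                 ≤⟨ far i j (K i) ℕ.≤-refl ⟩
    (e i + e i) + (e j + (e j + e j))             ≤⟨ ℚ.+-mono-≤ (ℚ.+-mono-≤ (hN i p) (hN i p)) (ℚ.+-mono-≤ (hN j q) (ℚ.+-mono-≤ (hN j q) (hN j q))) ⟩
    (δ + δ) + (δ + (δ + δ))                       ≡⟨ solve 1 (λ d → (d :+ d) :+ (d :+ (d :+ d)) := con ⌜ ℤ.+ 5 ⌝ :* d) refl δ ⟩
    ⌜ ℤ.+ 5 ⌝ * δ                                 ≡⟨ eq ⟩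
    ε                                             ∎
  converges : ∀ j ε → 0ℚ < ε → ∃ λ N → ∀ n → N ℕ.≤ n → ∣ x j n - s n ∣ ≤ (e j + e j) + ε
  converges j ε 0<ε =
    let δ , 0<δ , eq = scale 0<ε (0<⌜+suc⌝ 2)
        N , hN = ι-archimedean δ 0<δ
    in K j ℕ.⊔ N , λ n p → begin
    ∣ x j n - s n ∣                               ≤⟨ far j n n (ℕ.m⊔n≤o⇒m≤o (K j) N p) ⟩
    (e j + e j) + (e n + (e n + e n))             ≤⟨ ℚ.+-monoʳ-≤ (e j + e j) (let q = hN n (ℕ.m⊔n≤o⇒n≤o (K j) N p) in ℚ.+-mono-≤ q (ℚ.+-mono-≤ q q)) ⟩
    (e j + e j) + (δ + (δ + δ))                   ≡⟨ cong (e j + e j +_) (solve 1 (λ d → d :+ (d :+ d) := con ⌜ ℤ.+ 3 ⌝ :* d) refl δ) ⟩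
    (e j + e j) + ⌜ ℤ.+ 3 ⌝ * δ                   ≡⟨ cong (e j + e j +_) eq ⟩
    (e j + e j) + ε                               ∎

-- Tails outside a box

Outside : ℕ → List (Vec ℕ⁺ k) → Set
Outside M R = Unique R × (∀ {v} → v ∈ R → v ∉ box M)

-- `R` is fixed before the index, so the index from which the bound holds may depend on it; `M` and
-- ε are uniform in `R`.
Tail : (Vec ℕ⁺ k → ℕ → ℚ) → ℕ → ℚ → Set
Tail w M ε = ∀ R → Outside M R → (λ i → ∑ℚ R λ v → w v i) ≲ (λ _ → ε)

VanishingTails : (Vec ℕ⁺ k → ℕ → ℚ) → Set
VanishingTails w = ∀ ε → 0ℚ < ε → ∃ λ M → Tail w M ε

box-mono : ∀ {M N} → M ℕ.≤ N → box {k} M ⊆ box N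
box-mono M≤N = box⊆ (All-≤-replicate M≤N)

Tail-mono : ∀ {w : Vec ℕ⁺ k → ℕ → ℚ} {M N ε} → M ℕ.≤ N → Tail w M ε → Tail w N ε
Tail-mono M≤N t R (u , out) = t R (u , λ v∈R v∈M → out v∈R (box-mono M≤N v∈M))

enclose : (vs : List (Vec ℕ⁺ k)) → ∃ λ B → vs ⊆ box B
enclose []       = 0 , λ ()
enclose (v ∷ vs) = let B , h = enclose vs in size v ℕ.⊔ B ,
  λ { (here refl) → size≤⇒box (ℕ.m≤m⊔n (size v) B) ; (there u∈) → box-mono (ℕ.m≤n⊔m (size v) B) (h u∈) }

remainder : ∀ {M} (N : Vec ℕ k) → All (M ℕ.≤_) N → ∃ λ R → rectangle N ↭ box M ++ R × Outside M R
remainder {M = M} N M≤N =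
  let R , p = complement (rectangle-unique (Vec.replicate _ M)) (box⊆ M≤N)
      u = Unique-resp-↭ p (rectangle-unique N)
  in R , p , ++-uniqueʳ (box M) u , ++-disjoint u

∑-remainder : ∀ {M} {S R : List (Vec ℕ⁺ k)} → S ↭ box M ++ R → (F : Vec ℕ⁺ k → ℚ) → ∑ℚ S F ≡ ∑ℚ (box M) F + ∑ℚ R F
∑-remainder {k} {M} p F = trans (∑ℚ-↭ p) (∑ℚ-++ (box {k} M))

-- A list outside `box M` fits between it and a larger box. By nonnegativity its sum is at most the
-- difference of the two box sums, each within ε/2 of the limit.
Sums⇒VanishingTails : {w : Vec ℕ⁺ k → ℕ → ℚ} {s : ℕ → ℚ} → (∀ v i → 0ℚ ≤ w v i) → Sums w s → VanishingTails w
Sums⇒VanishingTails {w = w} {s} 0≤w hs ε 0<ε = M , tail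
  where
  M = proj₁ (hs (ε * ½) (*-pos 0<ε 0<½))
  hM = proj₂ (hs (ε * ½) (*-pos 0<ε 0<½))
  tail : Tail w M ε
  tail R (u , out) = ≲-trans (pointwise bound) (+-mono-≲-halves
      (hM (Vec.replicate _ (M ℕ.⊔ K)) (All-≤-replicate (ℕ.m≤m⊔n M K)))
      (hM (Vec.replicate _ M) (All-≤-replicate ℕ.≤-refl)))
    where
    K = proj₁ (enclose R)
    R⊆K = proj₂ (enclose R)
    rest = remainder (Vec.replicate _ (M ℕ.⊔ K)) (All-≤-replicate (ℕ.m≤m⊔n M K))
    R′ = proj₁ rest
    p = proj₁ (proj₂ rest)
    open ℚ.≤-Reasoning
    open +-*-Solver
    R⊆R′ : R ⊆ R′
    R⊆R′ v∈ = ∈-remainder p (box-mono (ℕ.m≤n⊔m M K) (R⊆K v∈)) (out v∈)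
    bound : ∀ i → ∑ℚ R (λ v → w v i) ≤
      ∣ ∑ℚ (box (M ℕ.⊔ K)) (λ v → w v i) - s i ∣ + ∣ ∑ℚ (box M) (λ v → w v i) - s i ∣
    bound i = begin
      ∑ℚ R (λ v → w v i)                    ≤⟨ ∑ℚ-⊆ u R⊆R′ (λ v → 0≤w v i) ⟩
      r                                     ≡⟨ solve 2 (λ m r → r := (m :+ r) :- m) refl m r ⟩
      (m + r) - m                           ≤⟨ p≤∣p∣ _ ⟩
      ∣ (m + r) - m ∣                       ≤⟨ ∣p-r∣≤ (m + r) (s i) m ⟩
      ∣ (m + r) - s i ∣ + ∣ s i - m ∣       ≡⟨ cong₂ _+_ (cong (λ t → ∣ t - s i ∣) (sym (∑-remainder p (λ v → w v i)))) (∣p-q∣≡∣q-p∣ (s i) m) ⟩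
      _                                     ∎
      where
      m = ∑ℚ (box M) (λ v → w v i)
      r = ∑ℚ R′ (λ v → w v i)

-- Sums over boxes whose tails are at most 1/(j+1) are mutually close, by comparison with a common
-- larger box, and `complete` supplies their limit.
VanishingTails⇒Sums : {F : Vec ℕ⁺ k → ℕ → ℚ} → (∀ v → Cauchy (F v)) → VanishingTails (λ v i → ∣ F v i ∣) →
  ∃ λ (s : ℝ) → Sums F (seq s)
VanishingTails⇒Sums {F = F} F-cauchy tails = proj₁ limit , sums
  where
  open +-*-Solver
  e : ℕ → ℚ
  e = ι 1
  M : ℕ → ℕ
  M j = proj₁ (tails (e j) (0<ι1 j))
  x : ℕ → ℕ → ℚ
  x j i = ∑ℚ (box (M j)) λ v → F v i
  near : ∀ j N → All (M j ℕ.≤_) N → (λ i → ∣ ∑ℚ (rectangle N) (λ v → F v i) - x j i ∣) ≲ (λ _ → e j)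
  near j N Mj≤N = let R , p , out = remainder N Mj≤N in
    ≲-trans (pointwise λ i → ℚ.≤-trans
        (ℚ.≤-reflexive (cong ∣_∣ (trans (cong (_- x j i) (∑-remainder p (λ v → F v i))) (m+r-m≡r (x j i) _))))
        (∣∑ℚ∣≤ R))
      (proj₂ (tails (e j) (0<ι1 j)) R out)
    where
    m+r-m≡r : ∀ m r → (m + r) - m ≡ r
    m+r-m≡r = solve 2 (λ m r → (m :+ r) :- m := r) refl
  close : ∀ i j → (λ n → ∣ x i n - x j n ∣) ≲ (λ _ → e i + e j)
  close i j = ≲-trans
    (pointwise λ n → let y = ∑ℚ (rectangle N) (λ v → F v n) in
        subst (λ t → ∣ x i n - x j n ∣ ≤ t + ∣ y - x j n ∣) (∣p-q∣≡∣q-p∣ (x i n) y) (∣p-r∣≤ (x i n) y (x j n)))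
    (+-mono-≲ (near i N (All-≤-replicate (ℕ.m≤m⊔n (M i) (M j)))) (near j N (All-≤-replicate (ℕ.m≤n⊔m (M i) (M j)))))
    where N = Vec.replicate _ (M i ℕ.⊔ M j)
  limit : ∃ λ s → ∀ j → (λ n → ∣ x j n - seq s n ∣) ≲ (λ _ → e j + e j)
  limit = complete x (λ j → ∑-cauchy (box (M j)) {F} F-cauchy) close
  sums : Sums F (seq (proj₁ limit))
  sums ε 0<ε =
    -- A third of ε: one error from `near`, two from the diagonal limit.
    let δ , 0<δ , eq = scale 0<ε (0<⌜+suc⌝ 2)
        j , hj = ι-archimedean δ 0<δ
        ej≤δ = hj j ℕ.≤-refl
    in M j , λ N Mj≤N → ≲-weaken
      (ℚ.≤-trans (ℚ.+-mono-≤ ej≤δ (ℚ.+-mono-≤ ej≤δ ej≤δ)) (ℚ.≤-reflexive (trans (solve 1 (λ d → d :+ (d :+ d) := con ⌜ ℤ.+ 3 ⌝ :* d) refl δ) eq)))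
      (≲-trans (pointwise λ n → ∣p-r∣≤ (∑ℚ (rectangle N) (λ v → F v n)) (x j n) (seq (proj₁ limit) n)) (+-mono-≲ (near j N Mj≤N) (proj₂ limit j)))

-- Real and imaginary parts

-- The multipliers `μ*`, 1/n and `c̃` are all real, so the two parts never mix and one argument
-- covers both.
data Part : Set where
  real imaginary : Part

_⟨_⟩ : ℂ → Part → ℕ → ℚ
z ⟨ real ⟩      = seq (re z)
z ⟨ imaginary ⟩ = seq (im z)

module _ where
  open +-*-Solver

  ax-0y : ∀ a x y → a * x - 0ℚ * y ≡ a * x
  ax-0y = solve 3 (λ a x y → a :* x :- con 0ℚ :* y := a :* x) refl

  xa-y0 : ∀ a x y → x * a - y * 0ℚ ≡ x * a
  xa-y0 = solve 3 (λ a x y → x :* a :- y :* con 0ℚ := x :* a) refl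

  ay+0x : ∀ a x y → a * y + 0ℚ * x ≡ a * y
  ay+0x = solve 3 (λ a x y → a :* y :+ con 0ℚ :* x := a :* y) refl

  x0+ya : ∀ a x y → x * 0ℚ + y * a ≡ y * a
  x0+ya = solve 3 (λ a x y → x :* con 0ℚ :+ y :* a := y :* a) refl

part-cauchy : ∀ p z → Cauchy (z ⟨ p ⟩)
part-cauchy real      z = cauchy (re z)
part-cauchy imaginary z = cauchy (im z)

part-⊠ : ∀ p (f : Vec ℕ⁺ k → ℂ) n i →
  ((μ*ₖ ⊠ f) n ⟨ p ⟩) i ≡ ∑ℚ (unitaryDivisorsₖ n) λ e → μₖ e * (f (zipWith _÷_ n e) ⟨ p ⟩) i
part-⊠ real      f n i = trans (re-∑ (unitaryDivisorsₖ n) (λ e → μ*ₖ e *ℂ f (zipWith _÷_ n e)) i)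
  (∑ℚ-cong (unitaryDivisorsₖ n) λ {e} _ → ax-0y (μₖ e) (seq (re (f (zipWith _÷_ n e))) i) (seq (im (f (zipWith _÷_ n e))) i))
part-⊠ imaginary f n i = trans (im-∑ (unitaryDivisorsₖ n) (λ e → μ*ₖ e *ℂ f (zipWith _÷_ n e)) i)
  (∑ℚ-cong (unitaryDivisorsₖ n) λ {e} _ → ay+0x (μₖ e) (seq (re (f (zipWith _÷_ n e))) i) (seq (im (f (zipWith _÷_ n e))) i))

-- An arbitrary Boolean in place of the coprimality test lets the projection pass through the
-- conditional by cases.
part-if : ∀ p b z n i → ((if b then z /ℂ n else 0ℂ) ⟨ p ⟩) i ≡ (if b then (z ⟨ p ⟩) i * recip n else 0ℚ)
part-if real      true  z n i = refl
part-if real      false z n i = refl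
part-if imaginary true  z n i = refl
part-if imaginary false z n i = refl

part-term : ∀ p (f : Vec ℕ⁺ k → ℂ) q m i → (coefficientTerm f q m ⟨ p ⟩) i ≡
  (if does (Coprime? m q) then ((μ*ₖ ⊠ f) (zipWith _*⁺_ m q) ⟨ p ⟩) i * recip (∏⁺ (zipWith _*⁺_ m q)) else 0ℚ)
part-term real      f q m i = part-if real (does (Coprime? m q)) ((μ*ₖ ⊠ f) (zipWith _*⁺_ m q)) (∏⁺ (zipWith _*⁺_ m q)) i
part-term imaginary f q m i = part-if imaginary (does (Coprime? m q)) ((μ*ₖ ⊠ f) (zipWith _*⁺_ m q)) (∏⁺ (zipWith _*⁺_ m q)) i

part-expansion : ∀ p (ã : Vec ℕ⁺ k → ℂ) n q i → (expansionTerm ã n q ⟨ p ⟩) i ≡ (ã q ⟨ p ⟩) i * c̃ₖ q n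
part-expansion real      ã n q i = xa-y0 (c̃ₖ q n) (seq (re (ã q)) i) (seq (im (ã q)) i)
part-expansion imaginary ã n q i = x0+ya (c̃ₖ q n) (seq (re (ã q)) i) (seq (im (ã q)) i)

∣part∣≲∣z∣ : ∀ p z → (λ i → ∣ (z ⟨ p ⟩) i ∣) ≲ seq ∣ z ∣ℂ
∣part∣≲∣z∣ p z = ∣x∣≲√ (z ⟨ p ⟩) (λ i → seq (re z) i * seq (re z) i + seq (im z) i * seq (im z) i) (bound p)
  where
  bound : ∀ p i → (z ⟨ p ⟩) i * (z ⟨ p ⟩) i ≤ ∣ seq (re z) i * seq (re z) i + seq (im z) i * seq (im z) i ∣
  bound real      i = let x = seq (re z) i ; y = seq (im z) i in
    subst₂ _≤_ (ℚ.+-identityʳ (x * x)) (sym (ℚ.0≤p⇒∣p∣≡p (0≤p²+q² x y))) (ℚ.+-monoʳ-≤ (x * x) (0≤p*p y))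
  bound imaginary i = let x = seq (re z) i ; y = seq (im z) i in
    subst₂ _≤_ (ℚ.+-identityˡ (y * y)) (sym (ℚ.0≤p⇒∣p∣≡p (0≤p²+q² x y))) (ℚ.+-monoˡ-≤ (y * y) (0≤p*p x))

-- Rearrangement of the double series

∣p*q∣≤ : ∀ p {q C} → ∣ q ∣ ≤ C → ∣ p * q ∣ ≤ C * ∣ p ∣
∣p*q∣≤ p {q} ∣q∣≤C = ℚ.≤-trans (ℚ.≤-reflexive (trans (ℚ.∣p*q∣≡∣p∣*∣q∣ p q) (ℚ.*-comm ∣ p ∣ ∣ q ∣)))
  (ℚ.*-monoʳ-≤-nonNeg ∣ p ∣ {{ℚ.∣-∣-nonNeg p}} ∣q∣≤C)

-- Here `h d` stands for one component of g(d)/d and `T q m` for one component of the m-th term of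
-- ã_q. The sum of a constant over the unitary divisors expresses the weight 2^ω(d) in the form in
-- which the pairs are counted.
module Rearrangement {k} (h : Vec ℕ⁺ k → ℕ → ℚ) (T : Vec ℕ⁺ k → Vec ℕ⁺ k → ℕ → ℚ)
  (T-coprime : ∀ {q m} → Coprimeₖ m q → ∀ i → T q m i ≡ h (zipWith _*⁺_ m q) i)
  (T-¬coprime : ∀ {q m} → ¬ Coprimeₖ m q → ∀ i → T q m i ≡ 0ℚ)
  (T-cauchy : ∀ q m → Cauchy (T q m))
  (h-tails : VanishingTails λ d i → ∑ℚ (unitaryDivisorsₖ d) λ _ → ∣ h d i ∣) where

  T-quotient : ∀ d {q} → q ∈ unitaryDivisorsₖ d → ∀ i → T q (zipWith _÷_ d q) i ≡ h d i
  T-quotient d q∈ i = let m⊥q , eq = udₖ⁻ d q∈ in trans (T-coprime m⊥q i) (cong (λ d → h d i) eq)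

  swap÷ : Vec ℕ⁺ k × Vec ℕ⁺ k → Vec ℕ⁺ k × Vec ℕ⁺ k
  swap÷ (d , q) = q , zipWith _÷_ d q

  -- Only coprime pairs must have their product outside the box; on the others `T` vanishes.
  PairTail : ℕ → ℚ → Set
  PairTail M ε = ∀ R → Unique R → (∀ {q m} → (q , m) ∈ R → Coprimeₖ m q → zipWith _*⁺_ m q ∉ box M) →
    (λ i → ∑ℚ R λ (q , m) → ∣ T q m i ∣) ≲ (λ _ → ε)

  -- A pair (q , m) of coprime vectors is a vector d = m q with a unitary
  -- divisor q, and d has 2^ω(d) unitary divisors.
  pairTail : ∀ ε → 0ℚ < ε → ∃ λ M → PairTail M ε
  pairTail ε 0<ε = M , tail
    where
    M = proj₁ (h-tails ε 0<ε)
    tail : PairTail M ε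
    tail R u out = ≲-trans (pointwise bound) (proj₂ (h-tails ε 0<ε) D D-outside)
      where
      coprime? : ∀ qm → Dec (Coprimeₖ (proj₂ qm) (proj₁ qm))
      coprime? (q , m) = Coprime? m q
      R⁺ = filter coprime? R
      products = map (λ (q , m) → zipWith _*⁺_ m q) R
      K = proj₁ (enclose products)
      rest = remainder (Vec.replicate k (M ℕ.⊔ K)) (All-≤-replicate (ℕ.m≤m⊔n M K))
      -- The part outside `box M` of a box large enough to hold every product from `R`.
      D = proj₁ rest
      D-outside : Outside M D
      D-outside = proj₂ (proj₂ rest)
      ∣T∣ : ℕ → Vec ℕ⁺ k × Vec ℕ⁺ k → ℚ
      ∣T∣ i (q , m) = ∣ T q m i ∣
      R⁺⊆ : R⁺ ⊆ map swap÷ (pairs D unitaryDivisorsₖ)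
      R⁺⊆ {q , m} qm∈ =
        let qm∈R , m⊥q = ∈.∈-filter⁻ coprime? {xs = R} qm∈
            d = zipWith _*⁺_ m q
            q∈ , eq = udₖ⁺ m⊥q
            d∈ : d ∈ D
            d∈ = ∈-remainder (proj₁ (proj₂ rest))
                   (box-mono (ℕ.m≤n⊔m M K) (proj₂ (enclose products) (∈.∈-map⁺ (λ (q , m) → zipWith _*⁺_ m q) qm∈R)))
                   (out qm∈R m⊥q)
        in subst (λ m′ → (q , m′) ∈ map swap÷ (pairs D unitaryDivisorsₖ)) eq
             (∈.∈-map⁺ swap÷ {x = d , q} (∈-pairs⁺ {f = unitaryDivisorsₖ} d∈ q∈))
      bound : ∀ i → ∑ℚ R (λ (q , m) → ∣ T q m i ∣) ≤ ∑ℚ D (λ d → ∑ℚ (unitaryDivisorsₖ d) λ _ → ∣ h d i ∣)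
      bound i = begin
        ∑ℚ R (∣T∣ i)
          ≡⟨ ∑ℚ-cong R (λ {qm} _ → drop qm) ⟩
        ∑ℚ R (λ qm → if does (coprime? qm) then ∣T∣ i qm else 0ℚ)
          ≡⟨ ∑ℚ-filter coprime? R ⟨
        ∑ℚ R⁺ (∣T∣ i)
          ≤⟨ ∑ℚ-⊆ (Unique.filter⁺ coprime? u) R⁺⊆ (λ (q , m) → ℚ.0≤∣p∣ (T q m i)) ⟩
        ∑ℚ (map swap÷ (pairs D unitaryDivisorsₖ)) (∣T∣ i)
          ≡⟨ ∑ℚ-map (pairs D unitaryDivisorsₖ) ⟩
        ∑ℚ (pairs D unitaryDivisorsₖ) (λ dq → ∣T∣ i (swap÷ dq))
          ≡⟨ ∑ℚ-pairs D ⟩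
        ∑ℚ D (λ d → ∑ℚ (unitaryDivisorsₖ d) λ q → ∣ T q (zipWith _÷_ d q) i ∣)
          ≡⟨ ∑ℚ-cong D (λ {d} _ → ∑ℚ-cong (unitaryDivisorsₖ d) λ q∈ → cong ∣_∣ (T-quotient d q∈ i)) ⟩
        ∑ℚ D (λ d → ∑ℚ (unitaryDivisorsₖ d) λ _ → ∣ h d i ∣)
          ∎
        where
        open ℚ.≤-Reasoning
        drop : ∀ qm → ∣T∣ i qm ≡ (if does (coprime? qm) then ∣T∣ i qm else 0ℚ)
        drop qm = go (coprime? qm)
          where
          go : (c : Dec (Coprimeₖ (proj₂ qm) (proj₁ qm))) → ∣T∣ i qm ≡ (if does c then ∣T∣ i qm else 0ℚ)
          go (yes _)   = refl
          go (no m⊥̸q) = cong ∣_∣ (T-¬coprime m⊥̸q i)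

  -- For fixed q the pairs (q , m) with m outside a box have products outside it, so `pairTail`
  -- bounds the tails in m.
  coefficient : ∀ q → ∃ λ (s : ℝ) → Sums (T q) (seq s)
  coefficient q = VanishingTails⇒Sums (T-cauchy q) tails
    where
    tails : VanishingTails (λ m i → ∣ T q m i ∣)
    tails ε 0<ε = let M , tail = pairTail ε 0<ε in M , λ R (u , out) →
      ≲-trans (pointwise λ i → ℚ.≤-reflexive (sym (∑ℚ-map R {q ,_} {λ (q , m) → ∣ T q m i ∣})))
        (tail (map (q ,_) R) (Unique.map⁺ (cong proj₂) u) λ {q′} {m} qm∈ _ d∈ → out-of-box out qm∈ d∈)
      where
      out-of-box : ∀ {M R} → (∀ {v} → v ∈ R → v ∉ box M) → ∀ {q′ m} → (q′ , m) ∈ map (q ,_) R → zipWith _*⁺_ m q′ ∉ box M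
      out-of-box {M} out {q′} {m} qm∈ d∈ with _ , m∈ , refl ← ∈.∈-map⁻ (q ,_) qm∈ =
        out m∈ (rectangle⁺ (proj₁ (≼-*⁺ m q (rectangle⁻ (Vec.replicate k M) d∈))))

  module Expansion (a : Vec ℕ⁺ k → ℕ → ℚ) (a-sums : ∀ q → Sums (T q) (a q)) where

    -- A finite stand-in for `a q`, which is known only as a limit and cannot be expanded at a given
    -- index.
    A[_] : ℕ → Vec ℕ⁺ k → ℕ → ℚ
    A[ L ] q i = ∑ℚ (box L) λ m → T q m i

    approximate : ∀ (Q : List (Vec ℕ⁺ k)) ε → 0ℚ < ε → ∃ λ L₀ → ∀ L → L₀ ℕ.≤ L →
      (λ i → ∑ℚ Q λ q → ∣ A[ L ] q i - a q i ∣) ≲ (λ _ → ε)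
    approximate []      ε 0<ε = 0 , λ _ _ → pointwise λ _ → ℚ.<⇒≤ 0<ε
    approximate (q ∷ Q) ε 0<ε =
      let L , hL = a-sums q (ε * ½) (*-pos 0<ε 0<½)
          L′ , hL′ = approximate Q (ε * ½) (*-pos 0<ε 0<½)
      in L ℕ.⊔ L′ , λ l p → +-mono-≲-halves
        (hL (Vec.replicate k l) (All-≤-replicate (ℕ.m⊔n≤o⇒m≤o L L′ p)))
        (hL′ l (ℕ.m⊔n≤o⇒n≤o L L′ p))

    -- The bound ε on the pairs with q in `R` is independent of the truncation `L`; the truncation
    -- error δ is then removed by `≲-limit`.
    a-tails : VanishingTails (λ q i → ∣ a q i ∣)
    a-tails ε 0<ε = M , λ R (u , out) → ≲-limit λ δ 0<δ →
      let L , hL = approximate R δ 0<δ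
          P = pairs R (λ _ → box L)
          small : (λ i → ∑ℚ P λ (q , m) → ∣ T q m i ∣) ≲ (λ _ → ε)
          small = tail P (pairs-unique u (λ _ → rectangle-unique (Vec.replicate k L))) λ {q} {m} qm∈ _ d∈ →
            out (proj₁ (∈-pairs⁻ R (λ _ → box L) qm∈)) (rectangle⁺ (proj₂ (≼-*⁺ m q (rectangle⁻ (Vec.replicate k M) d∈))))
      in ≲-trans (pointwise (bound R L)) (+-mono-≲ small (hL L ℕ.≤-refl))
      where
      M = proj₁ (pairTail ε 0<ε)
      tail = proj₂ (pairTail ε 0<ε)
      open ℚ.≤-Reasoning
      bound : ∀ R L i → ∑ℚ R (λ q → ∣ a q i ∣) ≤
        ∑ℚ (pairs R λ _ → box L) (λ (q , m) → ∣ T q m i ∣) + ∑ℚ R (λ q → ∣ A[ L ] q i - a q i ∣)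
      bound R L i = begin
        ∑ℚ R (λ q → ∣ a q i ∣)
          ≤⟨ ∑ℚ-mono R (λ {q} _ → subst (λ t → ∣ a q i ∣ ≤ ∣ A[ L ] q i ∣ + t) (∣p-q∣≡∣q-p∣ (a q i) (A[ L ] q i)) (∣p∣≤∣q∣+∣p-q∣ (a q i) (A[ L ] q i))) ⟩
        ∑ℚ R (λ q → ∣ A[ L ] q i ∣ + ∣ A[ L ] q i - a q i ∣)
          ≤⟨ ∑ℚ-mono R (λ {q} _ → ℚ.+-monoˡ-≤ ∣ A[ L ] q i - a q i ∣ (∣∑ℚ∣≤ (box {k} L))) ⟩
        ∑ℚ R (λ q → ∑ℚ (box L) (λ m → ∣ T q m i ∣) + ∣ A[ L ] q i - a q i ∣)
          ≡⟨ ∑ℚ-+ R ⟩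
        ∑ℚ R (λ q → ∑ℚ (box L) (λ m → ∣ T q m i ∣)) + ∑ℚ R (λ q → ∣ A[ L ] q i - a q i ∣)
          ≡⟨ cong (_+ ∑ℚ R (λ q → ∣ A[ L ] q i - a q i ∣)) (∑ℚ-pairs R) ⟨
        ∑ℚ (pairs R λ _ → box L) (λ (q , m) → ∣ T q m i ∣) + ∑ℚ R (λ q → ∣ A[ L ] q i - a q i ∣)
          ∎

    -- The pairs with q in `rectangle N` and m in `box L` consist of `D`, on which the finite
    -- identity is exact, and a rest `R` covered by `pairTail`. The error is the sum over `R` plus
    -- the cost of truncating each `a q`, both weighted by at most `C`.
    expansion : ∀ n (s : ℕ → ℚ) →
      (∀ N → n ≼ N → ∀ i → ∑ℚ (rectangle N) (λ d → ∑ℚ (unitaryDivisorsₖ d) λ q → h d i * c̃ₖ q n) ≡ s i) →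
      Sums (λ q i → a q i * c̃ₖ q n) s
    expansion n s s-sum ε 0<ε = M , λ N M≤N →
      let L₀ , hL = approximate (rectangle N) (δ * ½) (*-pos 0<δ 0<½)
          L = M ℕ.⊔ L₀
          R , p = complement D-unique (D⊆ M≤N (ℕ.m≤m⊔n M L₀))
          u = Unique-resp-↭ p (pairs-unique (rectangle-unique N) (λ _ → rectangle-unique (Vec.replicate k L)))
          small = tail R (++-uniqueʳ D u) λ qm∈ m⊥q d∈ → ++-disjoint u qm∈ (∈-D m⊥q (box-mono (ℕ.m≤m⊔n M₁ (size n)) d∈))
      in ≲-trans (pointwise (bound N L R p))
           (≲-weaken (ℚ.≤-reflexive Cδ≡ε) (*-monoʳ-≲ {c = C} (ℚ.<⇒≤ 0<C) (+-mono-≲-halves small (hL L (ℕ.m≤n⊔m M L₀)))))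
      where
      C = proj₁ (c̃ₖ-bounded n)
      0<C = proj₁ (proj₂ (c̃ₖ-bounded n))
      c≤C = proj₂ (proj₂ (c̃ₖ-bounded n))
      δ = proj₁ (scale 0<ε 0<C)
      0<δ = proj₁ (proj₂ (scale 0<ε 0<C))
      Cδ≡ε = proj₂ (proj₂ (scale 0<ε 0<C))
      M₁ = proj₁ (pairTail (δ * ½) (*-pos 0<δ 0<½))
      tail = proj₂ (pairTail (δ * ½) (*-pos 0<δ 0<½))
      -- `M₁` serves the tail bound, and `size n` puts n inside the box, as `s-sum` requires.
      M = M₁ ℕ.⊔ size n
      n≼M : n ≼ Vec.replicate k M
      n≼M = rectangle⁻ (Vec.replicate k M) (size≤⇒box (ℕ.m≤n⊔m M₁ (size n)))
      -- Listing pairs by product and unitary divisor turns the sum over `D` into the left side of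
      -- `s-sum`.
      E = pairs (box M) unitaryDivisorsₖ
      D = map swap÷ E
      D-unique : Unique D
      D-unique = map-unique injective (pairs-unique (rectangle-unique (Vec.replicate k M)) udₖ-unique)
        where
        injective : ∀ {x y} → x ∈ E → y ∈ E → swap÷ x ≡ swap÷ y → x ≡ y
        injective {d , q} {d′ , q′} x∈ y∈ eq =
          let q∈ = proj₂ (∈-pairs⁻ (box M) unitaryDivisorsₖ x∈)
              q′∈ = proj₂ (∈-pairs⁻ (box M) unitaryDivisorsₖ y∈)
          in cong₂ _,_ (trans (sym (proj₂ (udₖ⁻ d q∈))) (trans (cong (λ (q , m) → zipWith _*⁺_ m q) eq) (proj₂ (udₖ⁻ d′ q′∈)))) (cong proj₁ eq)
      D⊆ : ∀ {N L} → All (M ℕ.≤_) N → M ℕ.≤ L → D ⊆ pairs (rectangle N) (λ _ → box L)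
      D⊆ {N} {L} M≤N M≤L {x} x∈ =
        let (d , q) , dq∈ , eq = ∈.∈-map⁻ swap÷ {xs = E} x∈
            d∈ , q∈ = ∈-pairs⁻ (box M) unitaryDivisorsₖ dq∈
            m≼ , q≼ = ≼-*⁺ (zipWith _÷_ d q) q (subst (_≼ Vec.replicate k M) (sym (proj₂ (udₖ⁻ d q∈))) (rectangle⁻ (Vec.replicate k M) d∈))
        in subst (_∈ pairs (rectangle N) (λ _ → box L)) (sym eq)
             (∈-pairs⁺ {f = λ _ → box L} (box⊆ M≤N (rectangle⁺ q≼)) (box-mono M≤L (rectangle⁺ m≼)))
      ∈-D : ∀ {q m} → Coprimeₖ m q → zipWith _*⁺_ m q ∈ box M → (q , m) ∈ D
      ∈-D {q} {m} m⊥q d∈ = let q∈ , eq = udₖ⁺ m⊥q in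
        subst (λ m′ → (q , m′) ∈ D) eq (∈.∈-map⁺ swap÷ {x = zipWith _*⁺_ m q , q} (∈-pairs⁺ {f = unitaryDivisorsₖ} d∈ q∈))
      t : ℕ → Vec ℕ⁺ k × Vec ℕ⁺ k → ℚ
      t i (q , m) = T q m i * c̃ₖ q n
      ∑D : ∀ i → ∑ℚ D (t i) ≡ s i
      ∑D i = begin
        ∑ℚ D (t i)
          ≡⟨ ∑ℚ-map E ⟩
        ∑ℚ E (λ dq → t i (swap÷ dq))
          ≡⟨ ∑ℚ-pairs (box {k} M) ⟩
        ∑ℚ (box M) (λ d → ∑ℚ (unitaryDivisorsₖ d) λ q → T q (zipWith _÷_ d q) i * c̃ₖ q n)
          ≡⟨ ∑ℚ-cong (box M) (λ {d} _ → ∑ℚ-cong (unitaryDivisorsₖ d) λ {q} q∈ → cong (_* c̃ₖ q n) (T-quotient d q∈ i)) ⟩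
        ∑ℚ (box M) (λ d → ∑ℚ (unitaryDivisorsₖ d) λ q → h d i * c̃ₖ q n)
          ≡⟨ s-sum (Vec.replicate k M) n≼M i ⟩
        s i ∎
        where open ≡.≡-Reasoning
      bound : ∀ N L R → pairs (rectangle N) (λ _ → box L) ↭ D ++ R → ∀ i →
        ∣ ∑ℚ (rectangle N) (λ q → a q i * c̃ₖ q n) - s i ∣ ≤
        C * (∑ℚ R (λ (q , m) → ∣ T q m i ∣) + ∑ℚ (rectangle N) (λ q → ∣ A[ L ] q i - a q i ∣))
      bound N L R p i = begin
        ∣ ∑ℚ Q (λ q → a q i * c̃ₖ q n) - s i ∣
          ≡⟨ cong ∣_∣ difference ⟩
        ∣ r - e ∣
          ≤⟨ ℚ.∣p-q∣≤∣p∣+∣q∣ r e ⟩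
        ∣ r ∣ + ∣ e ∣
          ≤⟨ ℚ.+-mono-≤ (∣∑ℚ∣≤ R) (∣∑ℚ∣≤ Q) ⟩
        ∑ℚ R (λ qm → ∣ t i qm ∣) + ∑ℚ Q (λ q → ∣ (A[ L ] q i - a q i) * c̃ₖ q n ∣)
          ≤⟨ ℚ.+-mono-≤ (∑ℚ-mono R λ {(q , m)} _ → ∣p*q∣≤ (T q m i) (c≤C q)) (∑ℚ-mono Q λ {q} _ → ∣p*q∣≤ (A[ L ] q i - a q i) (c≤C q)) ⟩
        ∑ℚ R (λ (q , m) → C * ∣ T q m i ∣) + ∑ℚ Q (λ q → C * ∣ A[ L ] q i - a q i ∣)
          ≡⟨ cong₂ _+_ (∑ℚ-*ˡ C R) (∑ℚ-*ˡ C Q) ⟩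
        C * ∑ℚ R (λ (q , m) → ∣ T q m i ∣) + C * ∑ℚ Q (λ q → ∣ A[ L ] q i - a q i ∣)
          ≡⟨ ℚ.*-distribˡ-+ C _ _ ⟨
        C * (∑ℚ R (λ (q , m) → ∣ T q m i ∣) + ∑ℚ Q (λ q → ∣ A[ L ] q i - a q i ∣)) ∎
        where
        open ℚ.≤-Reasoning
        open +-*-Solver
        Q = rectangle N
        r = ∑ℚ R (t i)
        e = ∑ℚ Q (λ q → (A[ L ] q i - a q i) * c̃ₖ q n)
        X = ∑ℚ Q (λ q → a q i * c̃ₖ q n)
        split-a : ∀ x y c → y * c + (x - y) * c ≡ c * x
        split-a = solve 3 (λ x y c → y :* c :+ (x :- y) :* c := c :* x) refl
        -- Adding `e` replaces each `a q` by its truncation, so the sum becomes one over all pairs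
        -- from `Q` and `box L`, which splits into `D` and `R`.
        X+e : X + e ≡ s i + r
        X+e = trans (sym (∑ℚ-+ Q)) (trans (∑ℚ-cong Q λ {q} _ → trans (split-a (A[ L ] q i) (a q i) (c̃ₖ q n))
            (trans (sym (∑ℚ-*ˡ (c̃ₖ q n) (box {k} L))) (∑ℚ-cong (box {k} L) λ {m} _ → ℚ.*-comm (c̃ₖ q n) (T q m i))))
          (trans (sym (∑ℚ-pairs Q {λ _ → box L} {t i})) (trans (∑ℚ-↭ p) (trans (∑ℚ-++ D) (cong (_+ r) (∑D i))))))
        difference : X - s i ≡ r - e
        difference = trans (solve 3 (λ x s e → x :- s := (x :+ e) :- s :- e) refl X (s i) e)
          (trans (cong (λ y → y - s i - e) X+e) (solve 3 (λ s r e → (s :+ r) :- s :- e := r :- e) refl (s i) r e))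

Sums-cong : ∀ {k} {F G : Vec ℕ⁺ k → ℕ → ℚ} {s : ℕ → ℚ} → (∀ v i → F v i ≡ G v i) → Sums F s → Sums G s
Sums-cong {s = s} F≡G h ε 0<ε = proj₁ (h ε 0<ε) , λ N M≤N →
  ≲-trans (pointwise λ i → ℚ.≤-reflexive (cong (λ t → ∣ t - s i ∣) (∑ℚ-cong (rectangle N) λ {v} _ → sym (F≡G v i)))) (proj₂ (h ε 0<ε) N M≤N)

-- Assembly of the expansion

module Component {k} (f : Vec ℕ⁺ k → ℂ) (weighted-tails : VanishingTails λ n → seq (weighted f n)) (part : Part) where

  g φ : Vec ℕ⁺ k → ℕ → ℚ
  g d = (μ*ₖ ⊠ f) d ⟨ part ⟩
  φ d = f d ⟨ part ⟩

  h : Vec ℕ⁺ k → ℕ → ℚ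
  h d i = g d i * recip (∏⁺ d)

  T : Vec ℕ⁺ k → Vec ℕ⁺ k → ℕ → ℚ
  T q m = coefficientTerm f q m ⟨ part ⟩

  T-coprime : ∀ {q m} → Coprimeₖ m q → ∀ i → T q m i ≡ h (zipWith _*⁺_ m q) i
  T-coprime {q} {m} m⊥q i = trans (part-term part f q m i)
    (cong (λ b → if b then h (zipWith _*⁺_ m q) i else 0ℚ) (dec-true (Coprime? m q) m⊥q))

  T-¬coprime : ∀ {q m} → ¬ Coprimeₖ m q → ∀ i → T q m i ≡ 0ℚ
  T-¬coprime {q} {m} m⊥̸q i = trans (part-term part f q m i)
    (cong (λ b → if b then h (zipWith _*⁺_ m q) i else 0ℚ) (dec-false (Coprime? m q) m⊥̸q))

  -- Counting the unitary divisors yields exactly the factor 2^ω(d) of `weighted`. The comparison is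
  -- only eventual because the modulus of a complex number is computed with a root rounded down.
  dominated : ∀ d → (λ i → ∑ℚ (unitaryDivisorsₖ d) λ _ → ∣ h d i ∣) ≲ seq (weighted f d)
  dominated d = ≲-trans
    (pointwise {y = λ i → c * (r * ∣ g d i ∣)} λ i → ℚ.≤-reflexive (count i))
    (≲-trans (*-monoʳ-≲ {c = c} (0≤⌜+⌝ (2 ℕ.^ Vec.sum (Vec.map ω d))) (*-monoʳ-≲ {c = r} (0≤recip (∏⁺ d)) (∣part∣≲∣z∣ part ((μ*ₖ ⊠ f) d))))
      (pointwise λ i → ℚ.≤-reflexive (cong (c *_) (ℚ.*-comm r (seq ∣ (μ*ₖ ⊠ f) d ∣ℂ i)))))
    where
    c = ⌜ ℤ.+ (2 ℕ.^ Vec.sum (Vec.map ω d)) ⌝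
    r = recip (∏⁺ d)
    count : ∀ i → ∑ℚ (unitaryDivisorsₖ d) (λ _ → ∣ h d i ∣) ≡ c * (r * ∣ g d i ∣)
    count i = trans (∑ℚ-const (unitaryDivisorsₖ d) ∣ h d i ∣)
      (cong₂ (λ l x → ⌜ ℤ.+ l ⌝ * x) (length-udₖ d)
        (trans (ℚ.∣p*q∣≡∣p∣*∣q∣ (g d i) r)
          (trans (cong (∣ g d i ∣ *_) (ℚ.0≤p⇒∣p∣≡p (0≤recip (∏⁺ d)))) (ℚ.*-comm ∣ g d i ∣ r))))

  h-tails : VanishingTails λ d i → ∑ℚ (unitaryDivisorsₖ d) λ _ → ∣ h d i ∣
  h-tails ε 0<ε = proj₁ (weighted-tails ε 0<ε) , λ R out →
    ≲-trans (∑ℚ-mono-≲ R dominated) (proj₂ (weighted-tails ε 0<ε) R out)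

  open Rearrangement h T T-coprime T-¬coprime (λ q m → part-cauchy part (coefficientTerm f q m)) h-tails public

  -- The finite form of the theorem, exact at each index: orthogonality selects the unitary divisors
  -- of n, and inversion sums g over them to f(n).
  f-sum : ∀ n N → n ≼ N → ∀ i → ∑ℚ (rectangle N) (λ d → ∑ℚ (unitaryDivisorsₖ d) λ q → h d i * c̃ₖ q n) ≡ φ n i
  f-sum n N n≼N i = begin
    ∑ℚ (rectangle N) (λ d → ∑ℚ (unitaryDivisorsₖ d) λ q → h d i * c̃ₖ q n)
      ≡⟨ ∑ℚ-cong (rectangle N) (λ {d} _ → ∑ℚ-cong (unitaryDivisorsₖ d) λ {q} _ → solve 3 (λ g r c → g :* r :* c := (r :* c) :* g) refl (g d i) (recip (∏⁺ d)) (c̃ₖ q n)) ⟩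
    ∑ℚ (rectangle N) (λ d → ∑ℚ (unitaryDivisorsₖ d) λ q → (recip (∏⁺ d) * c̃ₖ q n) * g d i)
      ≡⟨ c̃ₖ-orthogonality n n≼N (λ d → g d i) ⟩
    ∑ℚ (unitaryDivisorsₖ n) (λ d → g d i)
      ≡⟨ ∑ℚ-cong (unitaryDivisorsₖ n) (λ {d} _ → part-⊠ part f d i) ⟩
    ∑ℚ (unitaryDivisorsₖ n) (λ d → ∑ℚ (unitaryDivisorsₖ d) λ e → μₖ e * φ (zipWith _÷_ d e) i)
      ≡⟨ möbius-inversionₖ n (λ d → φ d i) ⟩
    φ n i ∎
    where
    open ≡.≡-Reasoning
    open +-*-Solver

0≤∣z∣ : ∀ z i → 0ℚ ≤ seq ∣ z ∣ℂ i
0≤∣z∣ z i = 0≤ι (√ℚ-num i (seq (re z) i * seq (re z) i + seq (im z) i * seq (im z) i)) i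

weighted-nonneg : ∀ {k} (f : Vec ℕ⁺ k → ℂ) n i → 0ℚ ≤ seq (weighted f n) i
weighted-nonneg f n i = *-mono-≤ {0ℚ} {⌜ ℤ.+ (2 ℕ.^ Vec.sum (Vec.map ω n)) ⌝} {0ℚ} ℚ.≤-refl 0≤b (0≤⌜+⌝ (2 ℕ.^ Vec.sum (Vec.map ω n))) 0≤b
  where
  z = seq ∣ (μ*ₖ ⊠ f) n ∣ℂ i
  0≤z : 0ℚ ≤ z
  0≤z = 0≤∣z∣ ((μ*ₖ ⊠ f) n) i
  0≤b : 0ℚ ≤ z * recip (∏⁺ n)
  0≤b = *-mono-≤ {0ℚ} {z} {0ℚ} {recip (∏⁺ n)} ℚ.≤-refl (0≤recip (∏⁺ n)) 0≤z (0≤recip (∏⁺ n))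

module Series {k} (f : Vec ℕ⁺ k → ℂ) (weighted-tails : VanishingTails λ n → seq (weighted f n)) where

  module Re = Component f weighted-tails real
  module Im = Component f weighted-tails imaginary

  ã : Vec ℕ⁺ k → ℂ
  ã q = proj₁ (Re.coefficient q) +i proj₁ (Im.coefficient q)

  ã-sums : ∀ p q → Sums (λ m → coefficientTerm f q m ⟨ p ⟩) (ã q ⟨ p ⟩)
  ã-sums real      q = proj₂ (Re.coefficient q)
  ã-sums imaginary q = proj₂ (Im.coefficient q)

  coefficients : ∀ q → HasSumℂ (coefficientTerm f q) (ã q)
  coefficients q = Sums⇒HasSumℂ {F = coefficientTerm f q} {ã q} (ã-sums real q) (ã-sums imaginary q)

  module ReX = Re.Expansion (λ q → ã q ⟨ real ⟩) (ã-sums real)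
  module ImX = Im.Expansion (λ q → ã q ⟨ imaginary ⟩) (ã-sums imaginary)

  expansion-sums : ∀ p n → Sums (λ q → expansionTerm ã n q ⟨ p ⟩) (f n ⟨ p ⟩)
  expansion-sums real      n = Sums-cong (λ q i → sym (part-expansion real ã n q i)) (ReX.expansion n (f n ⟨ real ⟩) (Re.f-sum n))
  expansion-sums imaginary n = Sums-cong (λ q i → sym (part-expansion imaginary ã n q i)) (ImX.expansion n (f n ⟨ imaginary ⟩) (Im.f-sum n))

  expands : ∀ n → HasSumℂ (expansionTerm ã n) (f n)
  expands n = Sums⇒HasSumℂ {F = expansionTerm ã n} {f n} (expansion-sums real n) (expansion-sums imaginary n)

  ∣expansionTerm∣≤ : ∀ n {C} → (∀ q → ∣ c̃ₖ q n ∣ ≤ C) → ∀ q i →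
    ∣ seq ∣ expansionTerm ã n q ∣ℂ i ∣ ≤ C * (∣ (ã q ⟨ real ⟩) i ∣ + ∣ (ã q ⟨ imaginary ⟩) i ∣)
  ∣expansionTerm∣≤ n {C} c≤C q i = begin
    ∣ seq ∣ expansionTerm ã n q ∣ℂ i ∣
      ≡⟨ ℚ.0≤p⇒∣p∣≡p (0≤∣z∣ (expansionTerm ã n q) i) ⟩
    seq ∣ expansionTerm ã n q ∣ℂ i
      ≤⟨ √[x²+y²]≤∣x∣+∣y∣ i ((expansionTerm ã n q ⟨ real ⟩) i) ((expansionTerm ã n q ⟨ imaginary ⟩) i) ⟩
    ∣ (expansionTerm ã n q ⟨ real ⟩) i ∣ + ∣ (expansionTerm ã n q ⟨ imaginary ⟩) i ∣
      ≡⟨ cong₂ (λ x y → ∣ x ∣ + ∣ y ∣) (part-expansion real ã n q i) (part-expansion imaginary ã n q i) ⟩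
    ∣ x * c ∣ + ∣ y * c ∣
      ≤⟨ ℚ.+-mono-≤ (scaled x) (scaled y) ⟩
    C * ∣ x ∣ + C * ∣ y ∣
      ≡⟨ ℚ.*-distribˡ-+ C ∣ x ∣ ∣ y ∣ ⟨
    C * (∣ x ∣ + ∣ y ∣) ∎
    where
    open ℚ.≤-Reasoning
    x = (ã q ⟨ real ⟩) i
    y = (ã q ⟨ imaginary ⟩) i
    c = c̃ₖ q n
    scaled : ∀ z → ∣ z * c ∣ ≤ C * ∣ z ∣
    scaled z = ∣p*q∣≤ z (c≤C q)

  -- Since `c̃ₖ` is bounded in q, the tails are controlled by those of the two parts of `ã`, each
  -- allotted half of ε/C. The outer absolute value matches the form that `VanishingTails⇒Sums`
  -- takes.
  absolute-tails : ∀ n → VanishingTails λ q i → ∣ seq ∣ expansionTerm ã n q ∣ℂ i ∣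
  absolute-tails n ε 0<ε =
    let C , 0<C , c≤C = c̃ₖ-bounded n
        δ , 0<δ , Cδ≡ε = scale 0<ε 0<C
        M , hM = ReX.a-tails (δ * ½) (*-pos 0<δ 0<½)
        N , hN = ImX.a-tails (δ * ½) (*-pos 0<δ 0<½)
    in M ℕ.⊔ N , λ R out → ≲-trans
      (pointwise λ i → ℚ.≤-trans (∑ℚ-mono R λ {q} _ → ∣expansionTerm∣≤ n c≤C q i) (ℚ.≤-reflexive (trans (∑ℚ-*ˡ C R) (cong (C *_) (∑ℚ-+ R)))))
      (≲-weaken (ℚ.≤-reflexive Cδ≡ε) (*-monoʳ-≲ {c = C} (ℚ.<⇒≤ 0<C) (+-mono-≲-halves
        (Tail-mono (ℕ.m≤m⊔n M N) hM R out) (Tail-mono (ℕ.m≤n⊔m M N) hN R out))))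

  absolutely : ∀ n → AbsolutelyConvergent (expansionTerm ã n)
  absolutely n =
    let s , sums = VanishingTails⇒Sums (λ q → cauchy ∣ expansionTerm ã n q ∣ℂ) (absolute-tails n)
    in s , Sums⇒HasSumℝ {F = λ q → ∣ expansionTerm ã n q ∣ℂ} {s} sums

theorem2 : ∀ (k : ℕ) .{{_ : NonZero k}} (f : Vec ℕ⁺ k → ℂ) →
    Convergentℝ (weighted f) →
    ∃ λ (ã : Vec ℕ⁺ k → ℂ) →
    (∀ q → HasSumℂ (coefficientTerm f q) (ã q)) ×
    (∀ n → HasSumℂ (expansionTerm ã n) (f n) × AbsolutelyConvergent (expansionTerm ã n))
theorem2 k f (s , hasSum) = ã , coefficients , λ n → expands n , absolutely n
  where
  open Series f (Sums⇒VanishingTails {w = λ n → seq (weighted f n)} (weighted-nonneg f) (HasSumℝ⇒Sums {F = weighted f} {s} hasSum))
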